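{- Let $\Gamma$ be a finite, simple, strongly connected digraph of order $n\geq 4$ which is not an undirected graph. Then $\dim(\Gamma)=n-2$ if and only if $\Gamma$ is isomorphic to one of $G_2[K_1,P_2,K_1]$, $G_1[K_1,K_t,K_{n-t-1}]$, $G_2[K_1,K_t,K_{n-t-1}]$, $G_2[K_t,K_{n-t-1},K_1]$, or $G_2[K_1,\overline{K}_{n-2},K_1]$ for some integer $t$ with $1\leq t\leq n-2$.
   Context: All digraphs are finite, simple (no loops, at most one arc from $x$ to $y$ for each ordered pair) and strongly connected. $\partial(x,y)$ is the length of a shortest directed path from $x$ to $y$; $\tilde\partial(x,y)=(\partial(x,y),\partial(y,x))$. A subset $\{w_1,\dots,w_m\}$ of $V(\Gamma)$ is a weakly resolving set if $(\tilde\partial(w_1,u),\dots,\tilde\partial(w_m,u))\neq(\tilde\partial(w_1,v),\dots,\tilde\partial(w_m,v))$ for all distinct vertices $u,v$; $\dim(\Gamma)$ (weak metric dimension) is the minimum size of a weakly resolving set. A digraph is an undirected graph if for every arc $(x,y)$, $(y,x)$ is also an arc. $K_t$ is the complete digraph on $t$ vertices (all ordered pairs of distinct vertices are arcs), $\overline{K}_t$ the digraph on $t$ vertices with no arcs, and $P_2$ the digraph on two vertices $a,b$ with the single arc $(a,b)$. $G_1$ is the digraph on $\{0,1,2\}$ with arcs $(0,1),(1,2),(2,1),(2,0)$; $G_2$ is the digraph on $\{0,1,2\}$ with arcs $(0,1),(1,0),(1,2),(2,1),(2,0)$. For a digraph $G$ on $\{0,1,\dots,m-1\}$ and digraphs $H_0,\dots,H_{m-1}$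 with disjoint vertex sets, the generalized lexicographic product $G[H_0,\dots,H_{m-1}]$ has vertex set $V(H_0)\cup\dots\cup V(H_{m-1})$, and for $x\in V(H_i)$, $y\in V(H_j)$ there is an arc $(x,y)$ iff either $i=j$ and $(x,y)$ is an arc of $H_i$, or $i\neq j$ and $(i,j)$ is an arc of $G$. -}

module Defs where

open import Data.Nat using (ℕ; zero; suc; _≤_; _∸_)
open import Data.Bool using (Bool; true; false; not)
open import Data.Fin using (Fin; zero; suc; _≟_)
open import Data.Fin.Subset using (Subset; _∈_; ∣_∣)
open import Data.Product using (Σ; ∃; ∃-syntax; _×_; _,_)
open import Data.Sum using (_⊎_)
open import Function.Bundles using (_↔_; Inverse)
open import Relation.Nullary using (¬_; yes; no)
open import Relation.Nullary.Decidable using (⌊_⌋)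
open import Relation.Binary.PropositionalEquality using (_≡_; _≢_; refl)

-- A digraph on vertex type V: arc x y ≡ true iff (x , y) is an arc.
-- (Simplicity "at most one arc x→y" is built in.)
Digraph : Set → Set
Digraph V = V → V → Bool

Loopless : {V : Set} → Digraph V → Set
Loopless {V} A = ∀ (x : V) → A x x ≡ false

data Walk {V : Set} (A : Digraph V) : V → V → ℕ → Set where
  nil  : ∀ {x} → Walk A x x 0
  cons : ∀ {x y z k} → A x y ≡ true → Walk A y z k → Walk A x z (suc k)

StronglyConnected : {V : Set} → Digraph V → Set
StronglyConnected {V} A = ∀ (x y : V) → ∃[ k ] Walk A x y k

Undirected : {V : Set} → Digraph V → Set
Undirected {V} A = ∀ (x y : V) → A x y ≡ true → A y x ≡ true

IsDist : {V : Set} → Digraph V → V → V → ℕ → Set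
IsDist A x y d = Walk A x y d × (∀ m → Data.Nat._<_ m d → ¬ Walk A x y m)

Distinguishes : {V : Set} → Digraph V → V → V → V → Set
Distinguishes A w u v =
  ∃[ d₁ ] ∃[ d₂ ] ∃[ e₁ ] ∃[ e₂ ]
    (IsDist A w u d₁ × IsDist A w v d₂ × IsDist A u w e₁ × IsDist A v w e₂
     × ((d₁ , e₁) ≢ (d₂ , e₂)))

WeaklyResolving : {n : ℕ} → Digraph (Fin n) → Subset n → Set
WeaklyResolving {n} A W =
  ∀ (u v : Fin n) → u ≢ v → ∃[ w ] (w ∈ W × Distinguishes A w u v)

HasDim : {n : ℕ} → Digraph (Fin n) → ℕ → Set
HasDim {n} A k =
  (∃[ W ] (WeaklyResolving A W × ∣ W ∣ ≡ k))
  × (∀ (W : Subset n) → WeaklyResolving A W → k ≤ ∣ W ∣)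

Iso : {V U : Set} → Digraph V → Digraph U → Set
Iso {V} {U} A B = Σ (V ↔ U) λ f → ∀ (x y : V) → A x y ≡ B (Inverse.to f x) (Inverse.to f y)

K : (t : ℕ) → Digraph (Fin t)
K t x y = not ⌊ x ≟ y ⌋

Kbar : (t : ℕ) → Digraph (Fin t)
Kbar t x y = false

P2 : Digraph (Fin 2)
P2 zero (suc zero) = true
P2 _ _ = false

G1 : Digraph (Fin 3)
G1 zero (suc zero) = true
G1 (suc zero) (suc (suc zero)) = true
G1 (suc (suc zero)) (suc zero) = true
G1 (suc (suc zero)) zero = true
G1 _ _ = false

G2 : Digraph (Fin 3)
G2 zero (suc zero) = true
G2 (suc zero) zero = true
G2 (suc zero) (suc (suc zero)) = true
G2 (suc (suc zero)) (suc zero) = true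
G2 (suc (suc zero)) zero = true
G2 _ _ = false

Lex : {m : ℕ} (G : Digraph (Fin m)) (s : Fin m → ℕ) (H : (i : Fin m) → Digraph (Fin (s i)))
    → Digraph (Σ (Fin m) λ i → Fin (s i))
Lex G s H (i , x) (j , y) with i ≟ j
... | yes refl = H i x y
... | no _ = G i j

size3 : ℕ → ℕ → ℕ → Fin 3 → ℕ
size3 a b c zero = a
size3 a b c (suc zero) = b
size3 a b c (suc (suc zero)) = c

comp3 : {a b c : ℕ} → Digraph (Fin a) → Digraph (Fin b) → Digraph (Fin c)
      → (i : Fin 3) → Digraph (Fin (size3 a b c i))
comp3 H₀ H₁ H₂ zero = H₀
comp3 H₀ H₁ H₂ (suc zero) = H₁
comp3 H₀ H₁ H₂ (suc (suc zero)) = H₂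

Lex3 : (G : Digraph (Fin 3)) {a b c : ℕ} → Digraph (Fin a) → Digraph (Fin b) → Digraph (Fin c)
     → Digraph (Σ (Fin 3) λ i → Fin (size3 a b c i))
Lex3 G {a} {b} {c} H₀ H₁ H₂ = Lex G (size3 a b c) (comp3 H₀ H₁ H₂)

Extremal : (n : ℕ) → Digraph (Fin n) → Set
Extremal n A =
  Iso A (Lex3 G2 (K 1) P2 (K 1))
  ⊎ (∃[ t ] (1 ≤ t × t ≤ n ∸ 2 ×
       (Iso A (Lex3 G1 (K 1) (K t) (K (n ∸ t ∸ 1)))
        ⊎ Iso A (Lex3 G2 (K 1) (K t) (K (n ∸ t ∸ 1)))
        ⊎ Iso A (Lex3 G2 (K t) (K (n ∸ t ∸ 1)) (K 1)))))
  ⊎ Iso A (Lex3 G2 (K 1) (Kbar (n ∸ 2)) (K 1))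

{-# OPTIONS --safe #-}
module Submission where

-- Two vertices are twins up to a third if every vertex other than these three sees them alike.
-- The complement of {x , y , z} is resolving unless two of x, y, z are twins up to the third, so no
-- resolving set has fewer than n − 2 vertices iff every triple contains such twins; a digraph with a
-- one-way arc always has a resolving set of n − 2 vertices.  The twin condition bounds the diameter
-- by 2, so that distances are determined by arcs, and it lets each vertex see at most two types of
-- other vertices (out-only, in-only, joined in both directions, not joined).
--
-- If a vertex has two out-only neighbours, the remaining vertices are mutually adjacent, and by
-- reversal the same holds for two in-only neighbours: the digraph is a cone over a complete digraph,
-- and the two types seen from the apex decide between G₁[K₁,K,K], G₂[K₁,K,K] and G₂[K,K,K₁].
-- If neither end of a one-way arc is such an apex, both ends are joined in both directions to all
-- other vertices, and these look alike from one another: the digraph is a suspension G₂[K₁,H,K₁]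
-- with H complete, edgeless or P₂.  Conversely, cones and suspensions satisfy the twin condition.

open import Defs
open import Data.Bool using (Bool; true; false; if_then_else_)
import Data.Bool.Properties as Bool
open import Data.Fin using (Fin; zero; suc; _≟_)
open import Data.Fin.Patterns using (0F; 1F; 2F)
open import Data.Fin.Permutation using (↔⇒≡)
open import Data.Fin.Properties using (any?; all?; +↔⊎; nonZeroIndex)
open import Data.Fin.Subset using (Subset; _∈_; _∉_; ∣_∣; _∪_; ∁; ⁅_⁆; ⊥; inside; outside)
import Data.Fin.Subset.Properties as Subset
open import Data.List using (List; []; _∷_; length; lookup; filter; allFin)
open import Data.List.Membership.Propositional using () renaming (_∈_ to _∈ˡ_)
open import Data.List.Membership.Propositional.Properties using (∈-filter⁺; ∈-filter⁻; ∈-lookup; ∈-allFin)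
open import Data.List.Relation.Unary.All as All using (All; []; _∷_)
open import Data.List.Relation.Unary.All.Properties using (All¬⇒¬Any; ¬Any⇒All¬)
open import Data.List.Relation.Unary.AllPairs using (AllPairs; []; _∷_)
open import Data.List.Relation.Unary.Any as Any using (here; there)
open import Data.List.Relation.Unary.Any.Properties using (lookup-index)
open import Data.List.Relation.Unary.Unique.Propositional using (Unique)
open import Data.List.Relation.Unary.Unique.Propositional.Properties using (filter⁺; allFin⁺)
open import Data.Nat using (ℕ; zero; suc; _+_; _≤_; _<_; _∸_; s≤s; s<s⁻¹; >-nonZero⁻¹)
open import Data.Nat.Induction using (<-rec)
import Data.Nat.Properties as ℕ
open import Data.Product using (Σ; Σ-syntax; ∃; ∃-syntax; ∃₂; _×_; _,_; proj₁; proj₂; map; map₂; swap)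
open import Data.Product.Properties using (≡-dec)
open import Data.Sum using (_⊎_; inj₁; inj₂; [_,_]′; fromInj₂)
  renaming (map to ⊎-map; map₂ to ⊎-map₂)
open import Data.Sum.Function.Propositional using (_⊎-↔_)
open import Data.Vec using (_∷_; here; there)
open import Data.Vec.Functional using (foldr)
open import Function using (_∘_; id; flip; case_of_)
open import Function.Bundles using (_⇔_; _↔_; Inverse; mk⇔; mk↔ₛ′; module Equivalence)
open import Function.Construct.Composition using (_↔-∘_)
open import Function.Construct.Identity using (↔-id)
open import Function.Construct.Symmetry using (↔-sym)
open import Function.Related.Propositional using (module EquationalReasoning)
open import Relation.Binary.Definitions using (DecidableEquality; Symmetric; tri<; tri≈; tri>)
open import Relation.Binary.PropositionalEquality
  using (_≡_; _≢_; refl; sym; trans; cong; cong₂; subst; ≢-sym; module ≡-Reasoning)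
open import Relation.Nullary using (¬_; Dec; yes; no; contradiction)
open import Relation.Nullary.Decidable using (map′; _×-dec_; _→-dec_; ¬?; ⌊_⌋; from-yes; decidable-stable)
open import Relation.Unary using (Decidable; U)

private
  variable
    k l m n : ℕ
    V V′ L L′ : Set

-- For the distance ∂ of a digraph, ⟪ ∂ ⟫ is the two-way distance ∂̃.
⟪_⟫ : (V → V → L) → V → V → L × L
⟪ f ⟫ x y = f x y , f y x

pattern none     = false , false
pattern forward  = true , false
pattern backward = false , true
pattern both     = true , true

-- Twins

Twins : (V → V → L) → V → V → V → Set
Twins f z x y = ∀ w → w ≢ x → w ≢ y → w ≢ z → f w x ≡ f w y

TwinTriples : (V → V → L) → Set
TwinTriples f = ∀ x y z → Twins f z x y ⊎ Twins f y x z ⊎ Twins f x y z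

distinct⇒twinTriples : {f : V → V → L} → DecidableEquality V →
  (∀ {x y z} → x ≢ y → x ≢ z → y ≢ z → Twins f z x y ⊎ Twins f y x z ⊎ Twins f x y z) → TwinTriples f
distinct⇒twinTriples _≟ⱽ_ triples x y z with x ≟ⱽ y | x ≟ⱽ z | y ≟ⱽ z
... | yes refl | _        | _        = inj₁ λ _ _ _ _ → refl
... | no _     | yes refl | _        = inj₂ (inj₁ λ _ _ _ _ → refl)
... | no _     | no _     | yes refl = inj₂ (inj₂ λ _ _ _ _ → refl)
... | no x≢y   | no x≢z   | no y≢z   = triples x≢y x≢z y≢z

twinTriples-map : {f : V → V → L} {g : V → V → L′} →
  (∀ {w x y} → w ≢ x → w ≢ y → f w x ≡ f w y → g w x ≡ g w y) → TwinTriples f → TwinTriples g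
twinTriples-map {f = f} {g} f⇒g triples x y z = ⊎-map twins (⊎-map twins twins) (triples x y z)
  where
  twins : ∀ {z x y} → Twins f z x y → Twins g z x y
  twins xy w w≢x w≢y w≢z = f⇒g w≢x w≢y (xy w w≢x w≢y w≢z)

module _ {f : V → V → L} (triples : TwinTriples f) where

  two-alike : ∀ {w x y z} → w ≢ x → w ≢ y → w ≢ z → f w x ≡ f w y ⊎ f w x ≡ f w z ⊎ f w y ≡ f w z
  two-alike {w} {x} {y} {z} w≢x w≢y w≢z with triples x y z
  ... | inj₁ xy        = inj₁ (xy w w≢x w≢y w≢z)
  ... | inj₂ (inj₁ xz) = inj₂ (inj₁ (xz w w≢x w≢z w≢y))
  ... | inj₂ (inj₂ yz) = inj₂ (inj₂ (yz w w≢y w≢z w≢x))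

  two-types : ∀ {w x y z r s} → w ≢ x → w ≢ y → w ≢ z → f w x ≡ r → f w y ≡ s → r ≢ s →
    f w z ≡ r ⊎ f w z ≡ s
  two-types w≢x w≢y w≢z refl refl x≁y with two-alike w≢x w≢y w≢z
  ... | inj₁ x~y        = contradiction x~y x≁y
  ... | inj₂ (inj₁ x~z) = inj₁ (sym x~z)
  ... | inj₂ (inj₂ y~z) = inj₂ (sym y~z)

  unlike-third⇒twins : ∀ {w x y z} → w ≢ x → w ≢ y → w ≢ z → f w x ≢ f w z → f w y ≢ f w z → Twins f z x y
  unlike-third⇒twins {w} {x} {y} {z} w≢x w≢y w≢z x≁z y≁z with triples x y z
  ... | inj₁ xy        = xy
  ... | inj₂ (inj₁ xz) = contradiction (xz w w≢x w≢z w≢y) x≁z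
  ... | inj₂ (inj₂ yz) = contradiction (yz w w≢y w≢z w≢x) y≁z

-- Finite sets of vertices

AllPairs-lookup : {R : V → V → Set} → Symmetric R → {xs : List V} → AllPairs R xs →
  ∀ {x y} → x ∈ˡ xs → y ∈ˡ xs → x ≢ y → R x y
AllPairs-lookup R-sym (rs ∷ _)  (here refl)  (here refl)  x≢x = contradiction refl x≢x
AllPairs-lookup R-sym (rs ∷ _)  (here refl)  (there y∈xs) _   = All.lookup rs y∈xs
AllPairs-lookup R-sym (rs ∷ _)  (there x∈xs) (here refl)  _   = R-sym (All.lookup rs x∈xs)
AllPairs-lookup R-sym (_ ∷ rss) (there x∈xs) (there y∈xs) x≢y = AllPairs-lookup R-sym rss x∈xs y∈xs x≢y

x∉p⇒∣⁅x⁆∪p∣≡1+∣p∣ : {x : Fin n} (p : Subset n) → x ∉ p → ∣ ⁅ x ⁆ ∪ p ∣ ≡ suc ∣ p ∣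
x∉p⇒∣⁅x⁆∪p∣≡1+∣p∣ {x = zero}  (outside ∷ p) _   = cong (suc ∘ ∣_∣) (Subset.∪-identityˡ p)
x∉p⇒∣⁅x⁆∪p∣≡1+∣p∣ {x = zero}  (inside ∷ p)  x∉p = contradiction here x∉p
x∉p⇒∣⁅x⁆∪p∣≡1+∣p∣ {x = suc x} (outside ∷ p) x∉p = x∉p⇒∣⁅x⁆∪p∣≡1+∣p∣ p (x∉p ∘ there)
x∉p⇒∣⁅x⁆∪p∣≡1+∣p∣ {x = suc x} (inside ∷ p)  x∉p = cong suc (x∉p⇒∣⁅x⁆∪p∣≡1+∣p∣ p (x∉p ∘ there))

∣p∣<n⇒∃∉ : (p : Subset n) → ∣ p ∣ < n → ∃ (_∉ p)
∣p∣<n⇒∃∉ (outside ∷ p) _   = zero , λ ()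
∣p∣<n⇒∃∉ (inside ∷ p)  p<n with ∣p∣<n⇒∃∉ p (s<s⁻¹ p<n)
... | x , x∉p = suc x , λ { (there x∈p) → x∉p x∈p }

distinct-outsiders : ∀ k (p : Subset n) → k + ∣ p ∣ ≤ n →
  ∃[ xs ] (length xs ≡ k × Unique xs × All (_∉ p) xs)
distinct-outsiders zero    p _       = [] , refl , [] , []
distinct-outsiders {n} (suc k) p 1+k+∣p∣≤n
  with k+1+∣p∣≤n ← subst (_≤ n) (sym (ℕ.+-suc k ∣ p ∣)) 1+k+∣p∣≤n
  with x , x∉p ← ∣p∣<n⇒∃∉ p (ℕ.m+n≤o⇒n≤o k k+1+∣p∣≤n)
  with xs , refl , xs! , xs∉ ← distinct-outsiders k (⁅ x ⁆ ∪ p)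
    (subst (λ i → k + i ≤ n) (sym (x∉p⇒∣⁅x⁆∪p∣≡1+∣p∣ p x∉p)) k+1+∣p∣≤n) =
  x ∷ xs , refl ,
  All.map (λ y∉ → λ { refl → y∉ (Subset.p⊆p∪q p (Subset.x∈⁅x⁆ x)) }) xs∉ ∷ xs! ,
  x∉p ∷ All.map (_∘ Subset.q⊆p∪q ⁅ x ⁆ p) xs∉

entries : List (Fin n) → Subset n
entries []       = ⊥
entries (x ∷ xs) = ⁅ x ⁆ ∪ entries xs

∈-entries⁻ : (xs : List (Fin n)) {v : Fin n} → v ∈ entries xs → v ∈ˡ xs
∈-entries⁻ []       v∈⊥ = contradiction v∈⊥ Subset.∉⊥
∈-entries⁻ (x ∷ xs) v∈  with Subset.x∈p∪q⁻ ⁅ x ⁆ (entries xs) v∈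
... | inj₁ v∈⁅x⁆ = here (Subset.x∈⁅y⁆⇒x≡y x v∈⁅x⁆)
... | inj₂ v∈xs  = there (∈-entries⁻ xs v∈xs)

∈-entries⁺ : {xs : List (Fin n)} {v : Fin n} → v ∈ˡ xs → v ∈ entries xs
∈-entries⁺ {xs = x ∷ xs} (here refl)  = Subset.p⊆p∪q (entries xs) (Subset.x∈⁅x⁆ x)
∈-entries⁺ {xs = x ∷ xs} (there v∈xs) = Subset.q⊆p∪q ⁅ x ⁆ (entries xs) (∈-entries⁺ v∈xs)

∣entries∣≡length : {xs : List (Fin n)} → Unique xs → ∣ entries xs ∣ ≡ length xs
∣entries∣≡length {n} [] = Subset.∣⊥∣≡0 n
∣entries∣≡length {xs = _ ∷ xs} (x∉xs ∷ xs!) = trans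
  (x∉p⇒∣⁅x⁆∪p∣≡1+∣p∣ (entries xs) (All¬⇒¬Any x∉xs ∘ ∈-entries⁻ xs)) (cong suc (∣entries∣≡length xs!))

fresh : {xs : List (Fin n)} → Unique xs → length xs < n → ∃[ v ] All (v ≢_) xs
fresh {xs = xs} xs! ∣xs∣<n
  with v , v∉ ← ∣p∣<n⇒∃∉ (entries xs) (subst (_< _) (sym (∣entries∣≡length xs!)) ∣xs∣<n) =
  v , ¬Any⇒All¬ xs (v∉ ∘ ∈-entries⁺)

without : List (Fin n) → Subset n
without xs = ∁ (entries xs)

∈-without⁺ : {xs : List (Fin n)} {v : Fin n} → All (v ≢_) xs → v ∈ without xs
∈-without⁺ {xs = xs} v∉xs = Subset.x∉p⇒x∈∁p (All¬⇒¬Any v∉xs ∘ ∈-entries⁻ xs)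

∉-without⁻ : {xs : List (Fin n)} {v : Fin n} → v ∉ without xs → v ∈ˡ xs
∉-without⁻ {xs = xs} = ∈-entries⁻ xs ∘ Subset.x∉∁p⇒x∈p

∣without∣≡n∸length : {xs : List (Fin n)} → Unique xs → ∣ without xs ∣ ≡ n ∸ length xs
∣without∣≡n∸length {n} {xs} xs! =
  trans (Subset.∣∁p∣≡n∸∣p∣ (entries xs)) (cong (n ∸_) (∣entries∣≡length xs!))

-- Resolving sets of a labelling

Unlike : (Fin n → Fin n → L) → Subset n → Fin n → Fin n → Set
Unlike f W u v = ∃[ w ] (w ∈ W × f w u ≢ f w v)

Resolving : (Fin n → Fin n → L) → Subset n → Set
Resolving f W = ∀ u v → u ≢ v → Unlike f W u v

Separating : (V → V → L) → Set
Separating f = ∀ {w x} → f w w ≡ f w x → w ≡ x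

module _ {f : Fin n → Fin n → L} where

  pairwise-unlike⇒resolving : Separating f → {xs : List (Fin n)} →
    AllPairs (Unlike f (without xs)) xs → Resolving f (without xs)
  pairwise-unlike⇒resolving separating {xs} unlike u v u≢v
    with u Subset.∈? without xs | v Subset.∈? without xs
  ... | yes u∈W | _       = u , u∈W , u≢v ∘ separating
  ... | no _    | yes v∈W = v , v∈W , u≢v ∘ sym ∘ separating ∘ sym
  ... | no u∉W  | no v∉W  = AllPairs-lookup (λ (w , w∈W , u≁v) → w , w∈W , ≢-sym u≁v) unlike
    (∉-without⁻ u∉W) (∉-without⁻ v∉W) u≢v

  unlike⊎alike : DecidableEquality L → ∀ W u v → Unlike f W u v ⊎ (∀ {w} → w ∈ W → f w u ≡ f w v)
  unlike⊎alike _≟ᴸ_ W u v with any? (λ w → (w Subset.∈? W) ×-dec ¬? (f w u ≟ᴸ f w v))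
  ... | yes unlike = inj₁ unlike
  ... | no ¬unlike = inj₂ λ {w} w∈W → decidable-stable (f w u ≟ᴸ f w v) λ u≁v → ¬unlike (w , w∈W , u≁v)

  n∸2≤∣resolving∣⇒twinTriples : DecidableEquality L → Separating f →
    (∀ W → Resolving f W → n ∸ 2 ≤ ∣ W ∣) → TwinTriples f
  n∸2≤∣resolving∣⇒twinTriples _≟ᴸ_ separating n∸2≤ = distinct⇒twinTriples _≟_ triples
    where
    triples : ∀ {x y z} → x ≢ y → x ≢ z → y ≢ z → Twins f z x y ⊎ Twins f y x z ⊎ Twins f x y z
    triples {x} {y} {z} x≢y x≢z y≢z
      with unlike⊎alike _≟ᴸ_ (without (x ∷ y ∷ z ∷ [])) x y
         | unlike⊎alike _≟ᴸ_ (without (x ∷ y ∷ z ∷ [])) x z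
         | unlike⊎alike _≟ᴸ_ (without (x ∷ y ∷ z ∷ [])) y z
    ... | inj₂ xy | _       | _       = inj₁ λ w w≢x w≢y w≢z → xy (∈-without⁺ (w≢x ∷ w≢y ∷ w≢z ∷ []))
    ... | inj₁ _  | inj₂ xz | _       = inj₂ (inj₁ λ w w≢x w≢z w≢y → xz (∈-without⁺ (w≢x ∷ w≢y ∷ w≢z ∷ [])))
    ... | inj₁ _  | inj₁ _  | inj₂ yz = inj₂ (inj₂ λ w w≢y w≢z w≢x → yz (∈-without⁺ (w≢x ∷ w≢y ∷ w≢z ∷ [])))
    ... | inj₁ xy | inj₁ xz | inj₁ yz = contradiction
      (n∸2≤ _ (pairwise-unlike⇒resolving separating ((xy ∷ xz ∷ []) ∷ (yz ∷ []) ∷ [] ∷ [])))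
      (ℕ.<⇒≱ (subst (_< n ∸ 2) (sym (∣without∣≡n∸length xyz!)) (ℕ.∸-monoʳ-< (ℕ.n<1+n 2) 3≤n)))
      where
      xyz! : Unique (x ∷ y ∷ z ∷ [])
      xyz! = (x≢y ∷ x≢z ∷ []) ∷ (y≢z ∷ []) ∷ [] ∷ []

      3≤n : 3 ≤ n
      3≤n = subst (_≤ n) (∣entries∣≡length xyz!) (Subset.∣p∣≤n (entries (x ∷ y ∷ z ∷ [])))

  twins⇒¬resolving : ∀ {W x y z} → x ≢ y → x ∉ W → y ∉ W → z ∉ W → Twins f z x y → ¬ Resolving f W
  twins⇒¬resolving x≢y x∉W y∉W z∉W twins resolving with w , w∈W , x≁y ← resolving _ _ x≢y =
    x≁y (twins w (λ { refl → x∉W w∈W }) (λ { refl → y∉W w∈W }) (λ { refl → z∉W w∈W }))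

  three-outsiders⇒¬resolving : TwinTriples f → ∀ {W} (xs : List (Fin n)) → length xs ≡ 3 → Unique xs →
    All (_∉ W) xs → ¬ Resolving f W
  three-outsiders⇒¬resolving triples (x ∷ y ∷ z ∷ []) refl
    ((x≢y ∷ x≢z ∷ []) ∷ (y≢z ∷ []) ∷ _) (x∉W ∷ y∉W ∷ z∉W ∷ []) with triples x y z
  ... | inj₁ xy        = twins⇒¬resolving x≢y x∉W y∉W z∉W xy
  ... | inj₂ (inj₁ xz) = twins⇒¬resolving x≢z x∉W z∉W y∉W xz
  ... | inj₂ (inj₂ yz) = twins⇒¬resolving y≢z y∉W z∉W x∉W yz

  twinTriples⇒n∸2≤∣resolving∣ : TwinTriples f → ∀ W → Resolving f W → n ∸ 2 ≤ ∣ W ∣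
  twinTriples⇒n∸2≤∣resolving∣ triples W resolving = ℕ.≮⇒≥ λ ∣W∣<n∸2 →
    let xs , ∣xs∣≡3 , xs! , xs∉W = distinct-outsiders 3 W (m<n∸2⇒3+m≤n ∣W∣<n∸2)
    in three-outsiders⇒¬resolving triples xs ∣xs∣≡3 xs! xs∉W resolving
    where
    m<n∸2⇒3+m≤n : ∀ {m} → m < n ∸ 2 → 3 + m ≤ n
    m<n∸2⇒3+m≤n m<n∸2 = ℕ.≰⇒> (ℕ.<⇒≱ m<n∸2 ∘ ℕ.m≤n+o⇒m∸n≤o n 2)

-- Distances

arc⇒≢ : (A : Digraph V) → Loopless A → ∀ {x y} → A x y ≡ true → x ≢ y
arc⇒≢ _ loopless {x} x→x refl = Bool.not-¬ x→x (loopless x)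

forward⇒≢ : (A : Digraph V) {x y : V} → ⟪ A ⟫ x y ≡ forward → x ≢ y
forward⇒≢ _ xy refl = Bool.not-¬ (cong proj₁ xy) (cong proj₂ xy)

isDist-unique : {A : Digraph V} {x y : V} {d e : ℕ} → IsDist A x y d → IsDist A x y e → d ≡ e
isDist-unique {d = d} {e} (p , shortest-p) (q , shortest-q) with ℕ.<-cmp d e
... | tri< d<e _ _ = contradiction p (shortest-q d d<e)
... | tri≈ _ d≡e _ = d≡e
... | tri> _ _ e<d = contradiction q (shortest-p e e<d)

isDist-self : {A : Digraph V} {x : V} → IsDist A x x 0
isDist-self = nil , λ _ ()

isDist-zero⇒≡ : {A : Digraph V} {x y : V} → IsDist A x y 0 → x ≡ y
isDist-zero⇒≡ (nil , _) = refl

isDist-suc⇒≢ : {A : Digraph V} {x y : V} {d : ℕ} → IsDist A x y (suc d) → y ≢ x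
isDist-suc⇒≢ xy refl = contradiction (isDist-unique xy isDist-self) λ ()

isDist-one⇒arc : {A : Digraph V} {x y : V} → IsDist A x y 1 → A x y ≡ true
isDist-one⇒arc (cons x→y nil , _) = x→y

arc⇒isDist-one : {A : Digraph V} {x y : V} → x ≢ y → A x y ≡ true → IsDist A x y 1
arc⇒isDist-one {A = A} {x} {y} x≢y x→y = cons x→y nil , shortest
  where
  shortest : ∀ k → k < 1 → ¬ Walk A x y k
  shortest zero    _        nil = x≢y refl
  shortest (suc _) (s≤s ())

isDist-tail : {A : Digraph V} {x y z : V} {k : ℕ} → A x y ≡ true → Walk A y z k →
  (∀ i → i < suc k → ¬ Walk A x z i) → IsDist A y z k
isDist-tail x→y p shortest = p , λ i i<k q → shortest (suc i) (s≤s i<k) (cons x→y q)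

Diameter≤2 : Digraph V → Set
Diameter≤2 A = ∀ x y → x ≢ y → A x y ≡ true ⊎ ∃[ z ] (A x z ≡ true × A z y ≡ true)

no-arc⇒via : {A : Digraph V} → Diameter≤2 A → ∀ {x y} → x ≢ y → A x y ≡ false →
  ∃[ z ] (A x z ≡ true × A z y ≡ true)
no-arc⇒via diam x≢y x↛y = fromInj₂ (λ x→y → contradiction x↛y (Bool.not-¬ x→y)) (diam _ _ x≢y)

diameter≤2⇒isDist : {A : Digraph V} → Diameter≤2 A → ∀ {x y} → x ≢ y → IsDist A x y (if A x y then 1 else 2)
diameter≤2⇒isDist {A = A} diam {x} {y} x≢y with A x y in xy
... | true  = arc⇒isDist-one x≢y xy
... | false with z , x→z , z→y ← no-arc⇒via diam x≢y xy = cons x→z (cons z→y nil) , shortest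
  where
  shortest : ∀ k → k < 2 → ¬ Walk A x y k
  shortest zero          _              nil            = x≢y refl
  shortest (suc zero)    _              (cons x→y nil) = Bool.not-¬ x→y xy
  shortest (suc (suc _)) (s≤s (s≤s ()))

least : {P : ℕ → Set} → Decidable P → ∀ k → P k → ∃[ d ] (P d × (∀ i → i < d → ¬ P i))
least {P} P? = <-rec _ search
  where
  search : ∀ k → (∀ {i} → i < k → P i → ∃[ d ] (P d × (∀ i → i < d → ¬ P i))) →
    P k → ∃[ d ] (P d × (∀ i → i < d → ¬ P i))
  search k smaller Pk with ℕ.anyUpTo? P? k
  ... | yes (i , i<k , Pi) = smaller i<k Pi
  ... | no ∄i              = k , Pk , λ i i<k Pi → ∄i (i , i<k , Pi)

walk? : (A : Digraph (Fin n)) (x y : Fin n) → Decidable (Walk A x y)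
walk? A x y zero    = map′ (λ { refl → nil }) (λ { nil → refl }) (x ≟ y)
walk? A x y (suc k) = map′ (λ { (_ , x→z , p) → cons x→z p }) (λ { (cons x→z p) → _ , x→z , p })
  (any? λ z → (A x z Bool.≟ true) ×-dec walk? A z y k)

first-arc : {A : Digraph V} {x y : V} {k : ℕ} → Walk A x y (suc k) → ∃[ z ] A x z ≡ true
first-arc (cons x→z _) = _ , x→z

last-arc : {A : Digraph V} {x y : V} {k : ℕ} → Walk A x y (suc k) → ∃[ z ] A z y ≡ true
last-arc (cons x→y nil)        = _ , x→y
last-arc (cons _ p@(cons _ _)) = last-arc p

out-neighbour : {A : Digraph V} → StronglyConnected A → ∀ {x y} → x ≢ y → ∃[ z ] A x z ≡ true
out-neighbour connected {x} {y} x≢y with connected x y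
... | zero  , nil = contradiction refl x≢y
... | suc _ , p   = first-arc p

in-neighbour : {A : Digraph V} → StronglyConnected A → ∀ {x y} → x ≢ y → ∃[ z ] A z y ≡ true
in-neighbour connected {x} {y} x≢y with connected x y
... | zero  , nil = contradiction refl x≢y
... | suc _ , p   = last-arc p

-- Weak metric dimension n − 2

module _ {A : Digraph (Fin n)} (connected : StronglyConnected A) where

  distance : ∀ x y → ∃ (IsDist A x y)
  distance x y with k , p ← connected x y = least (walk? A x y) k p

  ∂ : Fin n → Fin n → ℕ
  ∂ x y = proj₁ (distance x y)

  ∂-isDist : ∀ x y → IsDist A x y (∂ x y)
  ∂-isDist x y = proj₂ (distance x y)

  isDist⇒∂≡ : ∀ {x y d} → IsDist A x y d → ∂ x y ≡ d
  isDist⇒∂≡ {x} {y} = isDist-unique (∂-isDist x y)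

  ∂-separating : Separating ⟪ ∂ ⟫
  ∂-separating {w} {x} eq = isDist-zero⇒≡ (subst (IsDist A w x)
    (trans (sym (cong proj₁ eq)) (isDist⇒∂≡ isDist-self)) (∂-isDist w x))

  weaklyResolving⇔resolving : ∀ W → WeaklyResolving A W ⇔ Resolving ⟪ ∂ ⟫ W
  weaklyResolving⇔resolving W = mk⇔
    (λ weak u v u≢v → case weak u v u≢v of λ
      { (w , w∈W , _ , _ , _ , _ , wu , wv , uw , vw , unlike) → w , w∈W , λ eq → unlike
          (trans (sym (cong₂ _,_ (isDist⇒∂≡ wu) (isDist⇒∂≡ uw)))
            (trans eq (cong₂ _,_ (isDist⇒∂≡ wv) (isDist⇒∂≡ vw)))) })
    (λ resolving u v u≢v → case resolving u v u≢v of λ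
      { (w , w∈W , unlike) → w , w∈W , _ , _ , _ , _ ,
          ∂-isDist w u , ∂-isDist w v , ∂-isDist u w , ∂-isDist v w , unlike })

  arc≡⌊∂≟1⌋ : ∀ {x y} → x ≢ y → A x y ≡ ⌊ ∂ x y ℕ.≟ 1 ⌋
  arc≡⌊∂≟1⌋ {x} {y} x≢y with A x y in xy | ∂ x y ℕ.≟ 1
  ... | true  | yes _   = refl
  ... | true  | no ∂≢1  = contradiction (isDist⇒∂≡ (arc⇒isDist-one x≢y xy)) ∂≢1
  ... | false | no _    = refl
  ... | false | yes ∂≡1 = trans (sym xy) (isDist-one⇒arc (subst (IsDist A x y) ∂≡1 (∂-isDist x y)))

  ∂-alike⇒arcs-alike : ∀ {w x y} → w ≢ x → w ≢ y → ⟪ ∂ ⟫ w x ≡ ⟪ ∂ ⟫ w y → ⟪ A ⟫ w x ≡ ⟪ A ⟫ w y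
  ∂-alike⇒arcs-alike {w} {x} {y} w≢x w≢y eq = begin
    ⟪ A ⟫ w x                      ≡⟨ cong₂ _,_ (arc≡⌊∂≟1⌋ w≢x) (arc≡⌊∂≟1⌋ (≢-sym w≢x)) ⟩
    map is-one is-one (⟪ ∂ ⟫ w x)  ≡⟨ cong (map is-one is-one) eq ⟩
    map is-one is-one (⟪ ∂ ⟫ w y)  ≡⟨ cong₂ _,_ (arc≡⌊∂≟1⌋ w≢y) (arc≡⌊∂≟1⌋ (≢-sym w≢y)) ⟨
    ⟪ A ⟫ w y                      ∎
    where
    open ≡-Reasoning

    is-one : ℕ → Bool
    is-one d = ⌊ d ℕ.≟ 1 ⌋

  arcs-alike⇒∂-alike : Diameter≤2 A → ∀ {w x y} → w ≢ x → w ≢ y →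
    ⟪ A ⟫ w x ≡ ⟪ A ⟫ w y → ⟪ ∂ ⟫ w x ≡ ⟪ ∂ ⟫ w y
  arcs-alike⇒∂-alike diam {w} {x} {y} w≢x w≢y eq = begin
    ⟪ ∂ ⟫ w x                  ≡⟨ cong₂ _,_ (∂≡ w≢x) (∂≡ (≢-sym w≢x)) ⟩
    map hops hops (⟪ A ⟫ w x)  ≡⟨ cong (map hops hops) eq ⟩
    map hops hops (⟪ A ⟫ w y)  ≡⟨ cong₂ _,_ (∂≡ w≢y) (∂≡ (≢-sym w≢y)) ⟨
    ⟪ ∂ ⟫ w y                  ∎
    where
    open ≡-Reasoning

    hops : Bool → ℕ
    hops a = if a then 1 else 2

    ∂≡ : ∀ {x y} → x ≢ y → ∂ x y ≡ hops (A x y)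
    ∂≡ = isDist⇒∂≡ ∘ diameter≤2⇒isDist diam

  unequal-distances⇒unlike : ∀ {x y z i j} → IsDist A x z i → IsDist A y z j → j < i → ⟪ ∂ ⟫ z x ≢ ⟪ ∂ ⟫ z y
  unequal-distances⇒unlike xz yz j<i eq =
    ℕ.<⇒≢ j<i (sym (trans (sym (isDist⇒∂≡ xz)) (trans (cong proj₂ eq) (isDist⇒∂≡ yz))))

  -- The endpoint of a geodesic of length at least 3 sees its first three vertices at three
  -- different distances.
  twinTriples⇒diameter≤2 : TwinTriples ⟪ ∂ ⟫ → Diameter≤2 A
  twinTriples⇒diameter≤2 triples x y x≢y with distance x y
  ... | _ , nil , _ = contradiction refl x≢y
  ... | _ , cons x→y nil , _ = inj₁ x→y
  ... | _ , cons x→z (cons z→y nil) , _ = inj₂ (_ , x→z , z→y)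
  ... | _ , xy@(cons x→a ay@(cons a→b by@(cons _ _))) , shortest
    with ay-dist ← isDist-tail x→a ay shortest
    with by-dist ← isDist-tail a→b by (proj₂ ay-dist)
    with two-alike triples (≢-sym x≢y) (isDist-suc⇒≢ ay-dist) (isDist-suc⇒≢ by-dist)
  ... | inj₁ x~a        = contradiction x~a (unequal-distances⇒unlike (xy , shortest) ay-dist (ℕ.n<1+n _))
  ... | inj₂ (inj₁ x~b) = contradiction x~b
    (unequal-distances⇒unlike (xy , shortest) by-dist (ℕ.m<n⇒m<1+n (ℕ.n<1+n _)))
  ... | inj₂ (inj₂ a~b) = contradiction a~b (unequal-distances⇒unlike ay-dist by-dist (ℕ.n<1+n _))

  dist-twinTriples⇔arc-twinTriples : TwinTriples ⟪ ∂ ⟫ ⇔ (TwinTriples ⟪ A ⟫ × Diameter≤2 A)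
  dist-twinTriples⇔arc-twinTriples = mk⇔
    (λ triples → twinTriples-map ∂-alike⇒arcs-alike triples , twinTriples⇒diameter≤2 triples)
    (λ (triples , diam) → twinTriples-map (arcs-alike⇒∂-alike diam) triples)

  -- A vertex tells its out-only neighbours apart from its in-neighbours.
  one-way⇒resolving : Loopless A → ∀ {a b} → ⟪ A ⟫ a b ≡ forward →
    ∃[ W ] (Resolving ⟪ ∂ ⟫ W × ∣ W ∣ ≡ n ∸ 2)
  one-way⇒resolving loopless {a} {b} ab with c , c→a ← in-neighbour connected (≢-sym (forward⇒≢ A ab)) =
    without (b ∷ c ∷ []) ,
    pairwise-unlike⇒resolving ∂-separating
      (((a , ∈-without⁺ (a≢b ∷ a≢c ∷ []) , b≁c ∘ ∂-alike⇒arcs-alike a≢b a≢c) ∷ []) ∷ [] ∷ []) ,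
    ∣without∣≡n∸length ((b≢c ∷ []) ∷ [] ∷ [])
    where
    a≢b : a ≢ b
    a≢b = forward⇒≢ A ab

    a≢c : a ≢ c
    a≢c = ≢-sym (arc⇒≢ A loopless c→a)

    b≁c : ⟪ A ⟫ a b ≢ ⟪ A ⟫ a c
    b≁c eq = Bool.not-¬ c→a (trans (sym (cong proj₂ eq)) (cong proj₂ ab))

    b≢c : b ≢ c
    b≢c refl = b≁c refl

  dim⇔dist-twinTriples : Loopless A → ∀ {a b} → ⟪ A ⟫ a b ≡ forward → HasDim A (n ∸ 2) ⇔ TwinTriples ⟪ ∂ ⟫
  dim⇔dist-twinTriples loopless ab = mk⇔
    (λ (_ , minimal) → n∸2≤∣resolving∣⇒twinTriples (≡-dec ℕ._≟_ ℕ._≟_) ∂-separating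
      λ W → minimal W ∘ from (weaklyResolving⇔resolving W))
    (λ triples →
      let W , resolving , ∣W∣≡n∸2 = one-way⇒resolving loopless ab
      in (W , from (weaklyResolving⇔resolving W) resolving , ∣W∣≡n∸2) ,
         λ W → twinTriples⇒n∸2≤∣resolving∣ triples W ∘ to (weaklyResolving⇔resolving W))
    where open Equivalence using (to; from)

-- Homogeneous sets, cones and suspensions

Homogeneous : Digraph V → (V → Set) → Set
Homogeneous A P = ∀ {w x y} → P w → P x → P y → w ≢ x → w ≢ y → ⟪ A ⟫ w x ≡ ⟪ A ⟫ w y

homogeneous⇒symmetric : {A : Digraph V} (P : V → Set) → Homogeneous A P →
  ∀ {x y z} → P x → P y → P z → x ≢ y → x ≢ z → y ≢ z → A x y ≡ A y x
homogeneous⇒symmetric {A = A} P homogeneous {x} {y} {z} px py pz x≢y x≢z y≢z = cong proj₁ (begin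
  ⟪ A ⟫ x y  ≡⟨ homogeneous px py pz x≢y x≢z ⟩
  ⟪ A ⟫ x z  ≡⟨ cong swap (homogeneous pz px py (≢-sym x≢z) (≢-sym y≢z)) ⟩
  ⟪ A ⟫ y z  ≡⟨ homogeneous py pz px y≢z (≢-sym x≢y) ⟩
  ⟪ A ⟫ y x  ∎)
  where open ≡-Reasoning

homogeneous⇒same-up-to-swap : DecidableEquality V → {A : Digraph V} (P : V → Set) → Homogeneous A P →
  ∀ {u v x y} → P u → P v → P x → P y → u ≢ v → x ≢ y → ⟪ A ⟫ x y ≡ ⟪ A ⟫ u v ⊎ ⟪ A ⟫ x y ≡ ⟪ A ⟫ v u
homogeneous⇒same-up-to-swap _≟ⱽ_ {A} P homogeneous {u} {v} {x} {y} pu pv px py u≢v x≢y with v ≟ⱽ x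
... | yes refl = inj₂ (homogeneous pv py pu x≢y (≢-sym u≢v))
... | no v≢x   = inj₁ (begin
  ⟪ A ⟫ x y  ≡⟨ homogeneous px py pv x≢y (≢-sym v≢x) ⟩
  ⟪ A ⟫ x v  ≡⟨ cong swap (homogeneous pv px pu v≢x (≢-sym u≢v)) ⟩
  ⟪ A ⟫ u v  ∎)
  where open ≡-Reasoning

CompleteOff : Digraph V → V → Set
CompleteOff A w = ∀ u v → w ≢ u → w ≢ v → u ≢ v → A u v ≡ true

completeOff? : (A : Digraph (Fin n)) (w : Fin n) → Dec (CompleteOff A w)
completeOff? A w = all? λ u → all? λ v →
  ¬? (w ≟ u) →-dec ¬? (w ≟ v) →-dec ¬? (u ≟ v) →-dec (A u v Bool.≟ true)

record Cone (A : Digraph V) (s t : Bool × Bool) : Set where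
  field
    apex     : V
    complete : CompleteOff A apex
    typed    : ∀ {v} → apex ≢ v → ⟪ A ⟫ apex v ≡ s ⊎ ⟪ A ⟫ apex v ≡ t

  Seen : Bool × Bool → V → Set
  Seen r v = apex ≢ v × ⟪ A ⟫ apex v ≡ r

FullCone : Digraph V → Bool × Bool → Bool × Bool → Set
FullCone A s t = Σ[ cone ∈ Cone A s t ] (∃ (Cone.Seen cone s) × ∃ (Cone.Seen cone t))

record Suspension (A : Digraph V) : Set where
  field
    source target : V

  Rest : V → Set
  Rest v = source ≢ v × target ≢ v

  field
    one-way       : ⟪ A ⟫ source target ≡ forward
    source-joined : ∀ {v} → Rest v → ⟪ A ⟫ source v ≡ both
    target-joined : ∀ {v} → Rest v → ⟪ A ⟫ target v ≡ both
    homogeneous   : Homogeneous A Rest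

-- Cones and suspensions satisfy the twin condition

two-of-three-in-one-class : {P Q : V → Set} {R : V → V → Set} →
  (∀ {x y} → P x → P y → R x y) → (∀ {x y} → Q x → Q y → R x y) →
  ∀ {x y z} → P x ⊎ Q x → P y ⊎ Q y → P z ⊎ Q z → R x y ⊎ R x z ⊎ R y z
two-of-three-in-one-class P⇒R Q⇒R (inj₁ px) (inj₁ py) _         = inj₁ (P⇒R px py)
two-of-three-in-one-class P⇒R Q⇒R (inj₂ qx) (inj₂ qy) _         = inj₁ (Q⇒R qx qy)
two-of-three-in-one-class P⇒R Q⇒R (inj₁ px) (inj₂ _)  (inj₁ pz) = inj₂ (inj₁ (P⇒R px pz))
two-of-three-in-one-class P⇒R Q⇒R (inj₂ qx) (inj₁ _)  (inj₂ qz) = inj₂ (inj₁ (Q⇒R qx qz))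
two-of-three-in-one-class P⇒R Q⇒R (inj₁ _)  (inj₂ qy) (inj₂ qz) = inj₂ (inj₂ (Q⇒R qy qz))
two-of-three-in-one-class P⇒R Q⇒R (inj₂ _)  (inj₁ py) (inj₁ pz) = inj₂ (inj₂ (P⇒R py pz))

in-pair-≢⇒≡ : {a b w x y : V} → a ≡ w ⊎ b ≡ w → a ≡ x ⊎ b ≡ x → a ≡ y ⊎ b ≡ y →
  w ≢ x → w ≢ y → x ≡ y
in-pair-≢⇒≡ _           (inj₁ refl) (inj₁ refl) _   _   = refl
in-pair-≢⇒≡ _           (inj₂ refl) (inj₂ refl) _   _   = refl
in-pair-≢⇒≡ (inj₁ refl) (inj₁ refl) (inj₂ refl) w≢x _   = contradiction refl w≢x
in-pair-≢⇒≡ (inj₁ refl) (inj₂ refl) (inj₁ refl) _   w≢y = contradiction refl w≢y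
in-pair-≢⇒≡ (inj₂ refl) (inj₁ refl) (inj₂ refl) _   w≢y = contradiction refl w≢y
in-pair-≢⇒≡ (inj₂ refl) (inj₂ refl) (inj₁ refl) w≢x _   = contradiction refl w≢x

module _ {A : Digraph (Fin n)} {s t : Bool × Bool} (cone : Cone A s t) where
  open Cone cone

  off-apex-joined : ∀ {u v} → apex ≢ u → apex ≢ v → u ≢ v → ⟪ A ⟫ u v ≡ both
  off-apex-joined a≢u a≢v u≢v = cong₂ _,_ (complete _ _ a≢u a≢v u≢v) (complete _ _ a≢v a≢u (≢-sym u≢v))

  twins-up-to-apex : ∀ {x y} → apex ≢ x → apex ≢ y → Twins ⟪ A ⟫ apex x y
  twins-up-to-apex a≢x a≢y w w≢x w≢y w≢a =
    trans (off-apex-joined (≢-sym w≢a) a≢x w≢x) (sym (off-apex-joined (≢-sym w≢a) a≢y w≢y))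

  seen-alike⇒twins : ∀ {x y z} → apex ≢ x → apex ≢ y → ⟪ A ⟫ apex x ≡ ⟪ A ⟫ apex y → Twins ⟪ A ⟫ z x y
  seen-alike⇒twins a≢x a≢y x~y w w≢x w≢y _ with apex ≟ w
  ... | yes refl = x~y
  ... | no a≢w   = twins-up-to-apex a≢x a≢y w w≢x w≢y (≢-sym a≢w)

  two-seen-alike : ∀ {x y z} → apex ≢ x → apex ≢ y → apex ≢ z →
    ⟪ A ⟫ apex x ≡ ⟪ A ⟫ apex y ⊎ ⟪ A ⟫ apex x ≡ ⟪ A ⟫ apex z ⊎ ⟪ A ⟫ apex y ≡ ⟪ A ⟫ apex z
  two-seen-alike a≢x a≢y a≢z = two-of-three-in-one-class {R = λ u v → ⟪ A ⟫ apex u ≡ ⟪ A ⟫ apex v}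
    (λ us vs → trans us (sym vs)) (λ ut vt → trans ut (sym vt)) (typed a≢x) (typed a≢y) (typed a≢z)

  cone⇒twinTriples : TwinTriples ⟪ A ⟫
  cone⇒twinTriples = distinct⇒twinTriples _≟_ triples
    where
    triples : ∀ {x y z} → x ≢ y → x ≢ z → y ≢ z →
      Twins ⟪ A ⟫ z x y ⊎ Twins ⟪ A ⟫ y x z ⊎ Twins ⟪ A ⟫ x y z
    triples {x} {y} {z} x≢y x≢z y≢z with apex ≟ x | apex ≟ y | apex ≟ z
    ... | yes refl | _        | _        = inj₂ (inj₂ (twins-up-to-apex x≢y x≢z))
    ... | no _     | yes refl | _        = inj₂ (inj₁ (twins-up-to-apex (≢-sym x≢y) y≢z))
    ... | no _     | no _     | yes refl = inj₁ (twins-up-to-apex (≢-sym x≢z) (≢-sym y≢z))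
    ... | no a≢x   | no a≢y   | no a≢z   =
      ⊎-map (seen-alike⇒twins a≢x a≢y) (⊎-map (seen-alike⇒twins a≢x a≢z) (seen-alike⇒twins a≢y a≢z))
        (two-seen-alike a≢x a≢y a≢z)

  cone⇒diameter≤2 : Loopless A → StronglyConnected A → Diameter≤2 A
  cone⇒diameter≤2 loopless connected x y x≢y with apex ≟ x | apex ≟ y
  ... | no a≢x   | no a≢y   = inj₁ (complete x y a≢x a≢y x≢y)
  ... | yes refl | yes refl = contradiction refl x≢y
  ... | yes refl | no a≢y   with v , a→v ← out-neighbour connected x≢y with v ≟ y
  ...   | yes refl = inj₁ a→v
  ...   | no v≢y   = inj₂ (v , a→v , complete v y (arc⇒≢ A loopless a→v) a≢y v≢y)
  cone⇒diameter≤2 loopless connected x y x≢y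
      | no a≢x   | yes refl with v , v→a ← in-neighbour connected x≢y with v ≟ x
  ...   | yes refl = inj₁ v→a
  ...   | no v≢x   = inj₂ (v , complete x v a≢x (≢-sym (arc⇒≢ A loopless v→a)) (≢-sym v≢x) , v→a)

module _ {A : Digraph (Fin n)} (suspension : Suspension A) where
  open Suspension suspension

  Pole : Fin n → Set
  Pole v = source ≡ v ⊎ target ≡ v

  pole⊎rest : ∀ v → Pole v ⊎ Rest v
  pole⊎rest v with source ≟ v | target ≟ v
  ... | yes s≡v | _       = inj₁ (inj₁ s≡v)
  ... | no _    | yes t≡v = inj₁ (inj₂ t≡v)
  ... | no s≢v  | no t≢v  = inj₂ (s≢v , t≢v)

  pole-joined : ∀ {x v} → Pole x → Rest v → ⟪ A ⟫ x v ≡ both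
  pole-joined (inj₁ refl) = source-joined
  pole-joined (inj₂ refl) = target-joined

  pole-twins : ∀ {x y} → Pole x → Pole y → ∀ z → Twins ⟪ A ⟫ z x y
  pole-twins px py z w w≢x w≢y _ with pole⊎rest w
  ... | inj₁ pw = cong (⟪ A ⟫ w) (in-pair-≢⇒≡ pw px py w≢x w≢y)
  ... | inj₂ rw = cong swap (trans (pole-joined px rw) (sym (pole-joined py rw)))

  rest-twins : ∀ {x y} → Rest x → Rest y → ∀ z → Twins ⟪ A ⟫ z x y
  rest-twins rx ry z w w≢x w≢y _ with pole⊎rest w
  ... | inj₁ pw = trans (pole-joined pw rx) (sym (pole-joined pw ry))
  ... | inj₂ rw = homogeneous rw rx ry w≢x w≢y

  suspension⇒twinTriples : TwinTriples ⟪ A ⟫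
  suspension⇒twinTriples x y z = ⊎-map (λ xy → xy z) (⊎-map (λ xz → xz y) (λ yz → yz x))
    (two-of-three-in-one-class {R = λ u v → ∀ z → Twins ⟪ A ⟫ z u v} pole-twins rest-twins
      (pole⊎rest x) (pole⊎rest y) (pole⊎rest z))

  target→rest : Loopless A → StronglyConnected A → ∃[ v ] (A target v ≡ true × Rest v)
  target→rest loopless connected with v , t→v ← out-neighbour connected (≢-sym (forward⇒≢ A one-way)) =
    v , t→v , (λ { refl → Bool.not-¬ t→v (cong proj₂ one-way) }) , arc⇒≢ A loopless t→v

  suspension⇒diameter≤2 : Loopless A → StronglyConnected A → Diameter≤2 A
  suspension⇒diameter≤2 loopless connected x y x≢y with pole⊎rest x | pole⊎rest y
  ... | inj₁ px          | inj₂ ry          = inj₁ (cong proj₁ (pole-joined px ry))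
  ... | inj₂ rx          | inj₁ py          = inj₁ (cong proj₂ (pole-joined py rx))
  ... | inj₂ rx          | inj₂ ry          =
    inj₂ (source , cong proj₂ (source-joined rx) , cong proj₁ (source-joined ry))
  ... | inj₁ (inj₁ refl) | inj₁ (inj₁ refl) = contradiction refl x≢y
  ... | inj₁ (inj₂ refl) | inj₁ (inj₂ refl) = contradiction refl x≢y
  ... | inj₁ (inj₁ refl) | inj₁ (inj₂ refl) = inj₁ (cong proj₁ one-way)
  ... | inj₁ (inj₂ refl) | inj₁ (inj₁ refl) with v , t→v , rest ← target→rest loopless connected =
    inj₂ (v , t→v , cong proj₂ (source-joined rest))

-- Classification under the twin condition

twinTriples-flip : {A : Digraph V} → TwinTriples ⟪ A ⟫ → TwinTriples ⟪ flip A ⟫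
twinTriples-flip = twinTriples-map λ _ _ → cong swap

diameter≤2-flip : {A : Digraph V} → Diameter≤2 A → Diameter≤2 (flip A)
diameter≤2-flip diam x y x≢y = ⊎-map₂ (λ (z , y→z , z→x) → z , z→x , y→z) (diam y x (≢-sym x≢y))

completeOff-flip : (A : Digraph V) {w : V} → CompleteOff (flip A) w → CompleteOff A w
completeOff-flip _ complete u v w≢u w≢v u≢v = complete v u w≢v w≢u (≢-sym u≢v)

module TwoOutOnlyNeighbours {A : Digraph (Fin n)} (loopless : Loopless A)
  (triples : TwinTriples ⟪ A ⟫) (diam : Diameter≤2 A)
  {w x₁ x₂ : Fin n} (x₁≢x₂ : x₁ ≢ x₂) (wx₁ : ⟪ A ⟫ w x₁ ≡ forward) (wx₂ : ⟪ A ⟫ w x₂ ≡ forward) where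

  Out In : Fin n → Set
  Out v = ⟪ A ⟫ w v ≡ forward
  In v = A v w ≡ true

  out≢ : ∀ {v} → Out v → w ≢ v
  out≢ = forward⇒≢ A

  in≢ : ∀ {v} → In v → w ≢ v
  in≢ = ≢-sym ∘ arc⇒≢ A loopless

  out-in-unlike : ∀ {x y} → Out x → In y → ⟪ A ⟫ w x ≢ ⟪ A ⟫ w y
  out-in-unlike wx y→w eq = Bool.not-¬ y→w (trans (sym (cong proj₂ eq)) (cong proj₂ wx))

  out-in-≢ : ∀ {x y} → Out x → In y → x ≢ y
  out-in-≢ wx y→w refl = out-in-unlike wx y→w refl

  another-out : ∀ x → ∃[ x′ ] (Out x′ × x ≢ x′)
  another-out x with x ≟ x₁
  ... | yes refl = x₂ , wx₂ , x₁≢x₂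
  ... | no x≢x₁  = x₁ , wx₁ , x≢x₁

  some-in : ∃ In
  some-in = map₂ proj₂ (no-arc⇒via diam (≢-sym (out≢ wx₁)) (cong proj₂ wx₁))

  y₀ : Fin n
  y₀ = proj₁ some-in

  y₀→w : In y₀
  y₀→w = proj₂ some-in

  out⊎in : ∀ {v} → w ≢ v → Out v ⊎ In v
  out⊎in w≢v = ⊎-map₂ (cong proj₂)
    (two-types triples (out≢ wx₁) (in≢ y₀→w) w≢v wx₁ (cong (A w y₀ ,_) y₀→w) λ ())

  out-twins : ∀ {x x′ y} → Out x → Out x′ → In y → Twins ⟪ A ⟫ y x x′
  out-twins wx wx′ y→w = unlike-third⇒twins triples (out≢ wx) (out≢ wx′) (in≢ y→w)
    (out-in-unlike wx y→w) (out-in-unlike wx′ y→w)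

  in-twins : ∀ {y y′ x} → In y → In y′ → Out x → Twins ⟪ A ⟫ x y y′
  in-twins y→w y′→w wx = unlike-third⇒twins triples (in≢ y→w) (in≢ y′→w) (out≢ wx)
    (≢-sym (out-in-unlike wx y→w)) (≢-sym (out-in-unlike wx y′→w))

  out-homogeneous : Homogeneous A Out
  out-homogeneous wv wx wx′ v≢x v≢x′ = out-twins wx wx′ y₀→w _ v≢x v≢x′ (out-in-≢ wv y₀→w)

  out→in : ∀ {x y} → Out x → In y → A x y ≡ true
  out→in {x} {y} wx y→w
    with z , x→z , z→w ← no-arc⇒via diam (≢-sym (out≢ wx)) (cong proj₂ wx)
    with x′ , wx′ , x≢x′ ← another-out x
    = trans (cong proj₁ (in-twins y→w z→w wx′ x (out-in-≢ wx y→w) (out-in-≢ wx z→w) x≢x′)) x→z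

  -- If the path u′ → z → u passed through In, then u would see w, u′ and z in three types.
  out-not-one-way : ∀ {u u′} → Out u → Out u′ → ⟪ A ⟫ u u′ ≢ forward
  out-not-one-way {u} {u′} wu wu′ uu′
    with z , u′→z , z→u ← no-arc⇒via diam (≢-sym (forward⇒≢ A uu′)) (cong proj₂ uu′)
    = [ via-out , via-in ]′ (out⊎in λ { refl → Bool.not-¬ u′→z (cong proj₂ wu′) })
    where
    u≢z : u ≢ z
    u≢z = ≢-sym (arc⇒≢ A loopless z→u)

    via-out : ¬ Out z
    via-out wz = Bool.not-¬ (cong proj₁ uu′) (trans (homogeneous⇒symmetric Out out-homogeneous
      wu wu′ wz (forward⇒≢ A uu′) u≢z (arc⇒≢ A loopless u′→z)) (cong proj₂ uu′))

    via-in : ¬ In z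
    via-in z→w with two-types triples (≢-sym (out≢ wu)) (forward⇒≢ A uu′) u≢z (cong swap wu) uu′ (λ ())
    ... | inj₁ uz = Bool.not-¬ (out→in wu z→w) (cong proj₁ uz)
    ... | inj₂ uz = Bool.not-¬ z→u (cong proj₂ uz)

  in→out : ∀ {x y} → Out x → In y → A y x ≡ true
  in→out {x} {y} wx y→w with A y x in y↛x
  ... | true  = refl
  ... | false
    with x′ , wx′ , x≢x′ ← another-out x
    with two-types triples (≢-sym (out≢ wx)) (out-in-≢ wx y→w) x≢x′
           (cong swap wx) (cong₂ _,_ (out→in wx y→w) y↛x) (λ ())
  ... | inj₁ x′→x = contradiction (cong swap x′→x) (out-not-one-way wx′ wx)
  ... | inj₂ x→x′ = contradiction x→x′ (out-not-one-way wx wx′)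

  out-complete : ∀ {x x′} → Out x → Out x′ → x ≢ x′ → A x x′ ≡ true
  out-complete {x} wx wx′ x≢x′
    with two-types triples (≢-sym (out≢ wx)) (out-in-≢ wx y₀→w) x≢x′
           (cong swap wx) (cong₂ _,_ (out→in wx y₀→w) (in→out wx y₀→w)) (λ ())
  ... | inj₁ x′→x = contradiction (cong swap x′→x) (out-not-one-way wx′ wx)
  ... | inj₂ x↔x′ = cong proj₁ x↔x′

  -- x₂ tells w and x₁ apart, so y sees y′ as it sees w or x₁.
  in-complete : ∀ {y y′} → In y → In y′ → y ≢ y′ → A y y′ ≡ true
  in-complete {y} {y′} y→w y′→w y≢y′ with triples w x₁ y′
  ... | inj₁ w~x₁         = contradiction
    (trans (cong proj₁ (w~x₁ x₂ (≢-sym (out≢ wx₂)) (≢-sym x₁≢x₂) (out-in-≢ wx₂ y′→w)))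
      (out-complete wx₂ wx₁ (≢-sym x₁≢x₂)))
    (λ x₂→w → Bool.not-¬ x₂→w (cong proj₂ wx₂))
  ... | inj₂ (inj₁ w~y′)  =
    trans (sym (cong proj₁ (w~y′ y (≢-sym (in≢ y→w)) y≢y′ (≢-sym (out-in-≢ wx₁ y→w))))) y→w
  ... | inj₂ (inj₂ x₁~y′) =
    trans (sym (cong proj₁ (x₁~y′ y (≢-sym (out-in-≢ wx₁ y→w)) y≢y′ (≢-sym (in≢ y→w))))) (in→out wx₁ y→w)

  complete-off : CompleteOff A w
  complete-off u v w≢u w≢v u≢v with out⊎in w≢u | out⊎in w≢v
  ... | inj₁ wu  | inj₁ wv  = out-complete wu wv u≢v
  ... | inj₁ wu  | inj₂ v→w = out→in wu v→w
  ... | inj₂ u→w | inj₁ wv  = in→out wv u→w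
  ... | inj₂ u→w | inj₂ v→w = in-complete u→w v→w u≢v

module _ {A : Digraph (Fin n)} (loopless : Loopless A)
  (triples : TwinTriples ⟪ A ⟫) (diam : Diameter≤2 A) where

  two-out-only⇒completeOff : ∀ {w x y} → x ≢ y → ⟪ A ⟫ w x ≡ forward → ⟪ A ⟫ w y ≡ forward → CompleteOff A w
  two-out-only⇒completeOff = TwoOutOnlyNeighbours.complete-off loopless triples diam

  two-in-only⇒completeOff : ∀ {w x y} → x ≢ y → ⟪ A ⟫ x w ≡ forward → ⟪ A ⟫ y w ≡ forward → CompleteOff A w
  two-in-only⇒completeOff x≢y xw yw = completeOff-flip A
    (TwoOutOnlyNeighbours.complete-off loopless (twinTriples-flip triples) (diameter≤2-flip diam) x≢y xw yw)

  ¬completeOff⇒source-joined : 4 ≤ n → ∀ {a b} → ⟪ A ⟫ a b ≡ forward → ¬ CompleteOff A a →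
    ∀ {v} → a ≢ v → b ≢ v → ⟪ A ⟫ a v ≡ both
  ¬completeOff⇒source-joined 4≤n {a} {b} ab incomplete a≢v b≢v
    with p , b→p , p→a ← no-arc⇒via diam (≢-sym (forward⇒≢ A ab)) (cong proj₂ ab)
    = trans (like-p a≢v b≢v) (cong (_, true) a→p)
    where
    a≢p : a ≢ p
    a≢p = ≢-sym (arc⇒≢ A loopless p→a)

    abp! : Unique (a ∷ b ∷ p ∷ [])
    abp! = (forward⇒≢ A ab ∷ a≢p ∷ []) ∷ (arc⇒≢ A loopless b→p ∷ []) ∷ [] ∷ []

    like-p : ∀ {v} → a ≢ v → b ≢ v → ⟪ A ⟫ a v ≡ (A a p , true)
    like-p a≢v b≢v = fromInj₂ (λ av → contradiction (two-out-only⇒completeOff b≢v ab av) incomplete)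
      (two-types triples (forward⇒≢ A ab) a≢p a≢v ab (cong (A a p ,_) p→a) λ ())

    a→p : A a p ≡ true
    a→p with A a p in a↛p
    ... | true  = refl
    ... | false with q , q≢a ∷ q≢b ∷ q≢p ∷ [] ← fresh abp! 4≤n = contradiction
      (two-in-only⇒completeOff (≢-sym q≢p) (cong₂ _,_ p→a a↛p)
        (cong swap (trans (like-p (≢-sym q≢a) (≢-sym q≢b)) (cong (_, true) a↛p))))
      incomplete

module _ {A : Digraph (Fin n)} (loopless : Loopless A)
  (triples : TwinTriples ⟪ A ⟫) (diam : Diameter≤2 A) where

  ¬completeOff⇒target-joined : 4 ≤ n → ∀ {a b} → ⟪ A ⟫ a b ≡ forward → ¬ CompleteOff A b →
    ∀ {v} → a ≢ v → b ≢ v → ⟪ A ⟫ b v ≡ both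
  ¬completeOff⇒target-joined 4≤n ab incomplete a≢v b≢v = cong swap
    (¬completeOff⇒source-joined {A = flip A} loopless (twinTriples-flip triples) (diameter≤2-flip diam)
      4≤n ab (incomplete ∘ completeOff-flip A) b≢v a≢v)

  ¬completeOff⇒suspension : 4 ≤ n → ∀ {a b} → ⟪ A ⟫ a b ≡ forward →
    ¬ CompleteOff A a → ¬ CompleteOff A b → Suspension A
  ¬completeOff⇒suspension 4≤n {a} {b} ab a-incomplete b-incomplete = record
    { one-way       = ab
    ; source-joined = λ (a≢v , b≢v) → a-joined a≢v b≢v
    ; target-joined = λ (a≢v , b≢v) → ¬completeOff⇒target-joined 4≤n ab b-incomplete a≢v b≢v
    ; homogeneous   = λ (_ , b≢w) (a≢x , b≢x) (a≢y , b≢y) w≢x w≢y →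
        unlike-third⇒twins triples a≢x a≢y (forward⇒≢ A ab) (unlike-b a≢x b≢x) (unlike-b a≢y b≢y)
          _ w≢x w≢y (≢-sym b≢w)
    }
    where
    a-joined : ∀ {v} → a ≢ v → b ≢ v → ⟪ A ⟫ a v ≡ both
    a-joined = ¬completeOff⇒source-joined loopless triples diam 4≤n ab a-incomplete

    unlike-b : ∀ {v} → a ≢ v → b ≢ v → ⟪ A ⟫ a v ≢ ⟪ A ⟫ a b
    unlike-b a≢v b≢v eq = contradiction (trans (sym (a-joined a≢v b≢v)) (trans eq ab)) λ ()

completeOff⇒fullCone : {A : Digraph (Fin n)} → TwinTriples ⟪ A ⟫ → ∀ {w x y s t} → CompleteOff A w →
  w ≢ x → w ≢ y → ⟪ A ⟫ w x ≡ s → ⟪ A ⟫ w y ≡ t → s ≢ t → FullCone A s t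
completeOff⇒fullCone triples complete w≢x w≢y wx wy s≢t = record
  { complete = complete
  ; typed    = λ w≢v → two-types triples w≢x w≢y w≢v wx wy s≢t
  } , (_ , w≢x , wx) , (_ , w≢y , wy)

-- Induced subdigraphs

lookup-injective : {xs : List V} → Unique xs → ∀ {i j} → lookup xs i ≡ lookup xs j → i ≡ j
lookup-injective (_ ∷ _)    {zero}  {zero}  _  = refl
lookup-injective (x∉xs ∷ _) {zero}  {suc j} eq = contradiction eq (All.lookup x∉xs (∈-lookup j))
lookup-injective (x∉xs ∷ _) {suc i} {zero}  eq = contradiction (sym eq) (All.lookup x∉xs (∈-lookup i))
lookup-injective (_ ∷ xs!)  {suc i} {suc j} eq = cong suc (lookup-injective xs! eq)

record Enumeration (P : V → Set) (k : ℕ) : Set where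
  field
    member           : Fin k → V
    member-∈         : ∀ i → P (member i)
    index            : ∀ {x} → P x → Fin k
    member-index     : ∀ {x} (px : P x) → member (index px) ≡ x
    member-injective : ∀ {i j} → member i ≡ member j → i ≡ j

enumerate : {P : Fin n → Set} → Decidable P → ∃ (Enumeration P)
enumerate {n} P? = length members , record
  { member           = lookup members
  ; member-∈         = λ i → proj₂ (∈-filter⁻ P? {xs = allFin n} (∈-lookup i))
  ; index            = λ px → Any.index (∈-filter⁺ P? (∈-allFin _) px)
  ; member-index     = λ px → sym (lookup-index (∈-filter⁺ P? (∈-allFin _) px))
  ; member-injective = lookup-injective (filter⁺ P? (allFin⁺ n))
  }
  where
  members : List (Fin n)
  members = filter P? (allFin n)

record Induces (A : Digraph V) (P : V → Set) (H : Digraph (Fin k)) : Set where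
  field
    enumeration : Enumeration P k

  open Enumeration enumeration public

  field
    arcs : ∀ i j → A (member i) (member j) ≡ H i j

inhabited⇒1≤order : {A : Digraph V} {P : V → Set} {H : Digraph (Fin k)} → Induces A P H → ∃ P → 1 ≤ k
inhabited⇒1≤order induces (_ , px) = >-nonZero⁻¹ _ ⦃ nonZeroIndex (Induces.index induces px) ⦄

edgeless-induces-Kbar : {A : Digraph (Fin n)} {P : Fin n → Set} → Decidable P →
  (∀ {x y} → P x → P y → A x y ≡ false) → ∃[ k ] Induces A P (Kbar k)
edgeless-induces-Kbar P? edgeless = _ , record
  { enumeration = proj₂ (enumerate P?)
  ; arcs        = λ i j → edgeless (member-∈ i) (member-∈ j)
  }
  where open Enumeration (proj₂ (enumerate P?))

module _ {A : Digraph (Fin n)} (loopless : Loopless A) where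

  complete-induces-K : {P : Fin n → Set} → Decidable P → (∀ {x y} → P x → P y → x ≢ y → A x y ≡ true) →
    ∃[ k ] Induces A P (K k)
  complete-induces-K P? complete = _ , record { enumeration = proj₂ (enumerate P?) ; arcs = arcs }
    where
    open Enumeration (proj₂ (enumerate P?))

    arcs : ∀ i j → A (member i) (member j) ≡ K _ i j
    arcs i j with i ≟ j
    ... | yes refl = loopless (member i)
    ... | no i≢j   = complete (member-∈ i) (member-∈ j) (i≢j ∘ member-injective)

  singleton-induces-K₁ : (w : Fin n) → Induces A (w ≡_) (K 1)
  singleton-induces-K₁ w = record
    { enumeration = record
      { member           = λ _ → w
      ; member-∈         = λ _ → refl
      ; index            = λ _ → zero
      ; member-index     = id
      ; member-injective = λ { {zero} {zero} _ → refl }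
      }
    ; arcs = λ { zero zero → loopless w }
    }

  one-way-pair-induces-P2 : {P : Fin n → Set} {u v : Fin n} → P u → P v → ⟪ A ⟫ u v ≡ forward →
    (∀ {x} → P x → u ≡ x ⊎ v ≡ x) → Induces A P P2
  one-way-pair-induces-P2 {P} {u} {v} pu pv uv u⊎v = record
    { enumeration = record
      { member           = member
      ; member-∈         = λ { 0F → pu ; 1F → pv }
      ; index            = index ∘ u⊎v
      ; member-index     = member-index ∘ u⊎v
      ; member-injective = member-injective _ _
      }
    ; arcs = λ { 0F 0F → loopless u ; 0F 1F → cong proj₁ uv ; 1F 0F → cong proj₂ uv ; 1F 1F → loopless v }
    }
    where
    member : Fin 2 → Fin n
    member 0F = u
    member 1F = v

    index : ∀ {x} → u ≡ x ⊎ v ≡ x → Fin 2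
    index (inj₁ _) = 0F
    index (inj₂ _) = 1F

    member-index : ∀ {x} (ux⊎vx : u ≡ x ⊎ v ≡ x) → member (index ux⊎vx) ≡ x
    member-index (inj₁ u≡x) = u≡x
    member-index (inj₂ v≡x) = v≡x

    member-injective : ∀ i j → member i ≡ member j → i ≡ j
    member-injective 0F 0F _   = refl
    member-injective 0F 1F u≡v = contradiction u≡v (forward⇒≢ A uv)
    member-injective 1F 0F v≡u = contradiction (sym v≡u) (forward⇒≢ A uv)
    member-injective 1F 1F _   = refl

data InducesKbar⊎K⊎P2 (A : Digraph V) (P : V → Set) : Set where
  induces-Kbar : Induces A P (Kbar k) → InducesKbar⊎K⊎P2 A P
  induces-K    : Induces A P (K k) → ∃ P → InducesKbar⊎K⊎P2 A P
  induces-P2   : Induces A P P2 → InducesKbar⊎K⊎P2 A P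

homogeneous⇒induces-Kbar⊎K⊎P2 : {A : Digraph (Fin n)} → Loopless A → {P : Fin n → Set} → Decidable P →
  Homogeneous A P → InducesKbar⊎K⊎P2 A P
homogeneous⇒induces-Kbar⊎K⊎P2 {A = A} loopless {P} P? homogeneous
  with any? (λ u → any? (λ v → P? u ×-dec P? v ×-dec (A u v Bool.≟ true)))
... | no ∄arc = induces-Kbar (proj₂ (edgeless-induces-Kbar P?
        λ px py → Bool.¬-not λ x→y → ∄arc (_ , _ , px , py , x→y)))
... | yes (u , v , pu , pv , u→v) with A v u in vu
...   | true  = induces-K (proj₂ (complete-induces-K loopless P? complete)) (u , pu)
  where
  complete : ∀ {x y} → P x → P y → x ≢ y → A x y ≡ true
  complete px py x≢y
    with homogeneous⇒same-up-to-swap _≟_ P homogeneous pu pv px py (arc⇒≢ A loopless u→v) x≢y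
  ... | inj₁ xy~uv = trans (cong proj₁ xy~uv) u→v
  ... | inj₂ xy~vu = trans (cong proj₁ xy~vu) vu
...   | false = induces-P2 (one-way-pair-induces-P2 loopless pu pv (cong₂ _,_ u→v vu) u⊎v)
  where
  u⊎v : ∀ {x} → P x → u ≡ x ⊎ v ≡ x
  u⊎v {x} px with u ≟ x | v ≟ x
  ... | yes u≡x | _       = inj₁ u≡x
  ... | no _    | yes v≡x = inj₂ v≡x
  ... | no u≢x  | no v≢x  = contradiction vu (Bool.not-¬ (trans
    (sym (homogeneous⇒symmetric P homogeneous pu pv px (arc⇒≢ A loopless u→v) u≢x v≢x)) u→v))

-- Recognizing generalized lexicographic products

Semicomplete : Digraph (Fin m) → Set
Semicomplete G = ∀ i j → i ≢ j → ⟪ G ⟫ i j ≢ none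

semicomplete? : (G : Digraph (Fin m)) → Dec (Semicomplete G)
semicomplete? G = all? λ i → all? λ j → ¬? (i ≟ j) →-dec ¬? (≡-dec Bool._≟_ Bool._≟_ (⟪ G ⟫ i j) none)

G1-semicomplete : Semicomplete G1
G1-semicomplete = from-yes (semicomplete? G1)

G2-semicomplete : Semicomplete G2
G2-semicomplete = from-yes (semicomplete? G2)

module _ {A : Digraph V} {G : Digraph (Fin m)} {s : Fin m → ℕ} {H : ∀ i → Digraph (Fin (s i))}
  {P : Fin m → V → Set} (loopless : Loopless A) (semicomplete : Semicomplete G)
  (cover : ∀ x → ∃[ i ] P i x) (parts : ∀ i → Induces A (P i) (H i))
  (links : ∀ {i j x y} → i ≢ j → P i x → P j y → A x y ≡ G i j) where

  private
    open module Part i = Induces (parts i)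

    disjoint : ∀ {i j x} → P i x → P j x → i ≡ j
    disjoint {i} {j} {x} pi pj with i ≟ j
    ... | yes i≡j = i≡j
    ... | no i≢j  =
      contradiction (cong₂ _,_ (no-arc i≢j pi pj) (no-arc (≢-sym i≢j) pj pi)) (semicomplete i j i≢j)
      where
      no-arc : ∀ {i j} → i ≢ j → P i x → P j x → G i j ≡ false
      no-arc i≢j pi pj = trans (sym (links i≢j pi pj)) (loopless x)

    to : V → Σ (Fin m) (Fin ∘ s)
    to x = proj₁ (cover x) , index _ (proj₂ (cover x))

    from : Σ (Fin m) (Fin ∘ s) → V
    from (i , u) = member i u

    from-to : ∀ x → from (to x) ≡ x
    from-to x = member-index _ (proj₂ (cover x))

    from-injective : ∀ {p q} → from p ≡ from q → p ≡ q
    from-injective {i , u} {j , v} eq with disjoint (member-∈ i u) (subst (P j) (sym eq) (member-∈ j v))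
    ... | refl = cong (i ,_) (member-injective i eq)

    from-arcs : ∀ p q → A (from p) (from q) ≡ Lex G s H p q
    from-arcs (i , u) (j , v) with i ≟ j
    ... | yes refl = arcs i u v
    ... | no i≢j   = links i≢j (member-∈ i u) (member-∈ j v)

  Lex-iso : Iso A (Lex G s H)
  Lex-iso = mk↔ₛ′ to from (λ p → from-injective (from-to (from p))) from-to ,
    λ x y → trans (sym (cong₂ A (from-to x) (from-to y))) (from-arcs (to x) (to y))

Linked : Digraph V → (V → Set) → (V → Set) → Bool × Bool → Set
Linked A P Q t = ∀ {x y} → P x → Q y → ⟪ A ⟫ x y ≡ t

Lex3-iso : {A : Digraph V} {G : Digraph (Fin 3)} {a b c : ℕ}
  {H₀ : Digraph (Fin a)} {H₁ : Digraph (Fin b)} {H₂ : Digraph (Fin c)} {P Q R : V → Set} →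
  Loopless A → Semicomplete G → (∀ x → P x ⊎ Q x ⊎ R x) →
  Induces A P H₀ → Induces A Q H₁ → Induces A R H₂ →
  Linked A P Q (⟪ G ⟫ 0F 1F) → Linked A P R (⟪ G ⟫ 0F 2F) → Linked A Q R (⟪ G ⟫ 1F 2F) →
  Iso A (Lex3 G H₀ H₁ H₂)
Lex3-iso {V} {A} {G} {P = P} {Q} {R} loopless semicomplete cover P-H₀ Q-H₁ R-H₂ PQ PR QR =
  Lex-iso {P = part} loopless semicomplete (λ x → [ 0F ,_ , [ 1F ,_ , 2F ,_ ]′ ]′ (cover x))
    (λ { 0F → P-H₀ ; 1F → Q-H₁ ; 2F → R-H₂ }) links
  where
  part : Fin 3 → V → Set
  part 0F = P
  part 1F = Q
  part 2F = R

  links : ∀ {i j x y} → i ≢ j → part i x → part j y → A x y ≡ G i j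
  links {0F} {0F} i≢i _ _ = contradiction refl i≢i
  links {0F} {1F} _   p q = cong proj₁ (PQ p q)
  links {0F} {2F} _   p r = cong proj₁ (PR p r)
  links {1F} {0F} _   q p = cong proj₂ (PQ p q)
  links {1F} {1F} i≢i _ _ = contradiction refl i≢i
  links {1F} {2F} _   q r = cong proj₁ (QR q r)
  links {2F} {0F} _   r p = cong proj₂ (PR p r)
  links {2F} {1F} _   r q = cong proj₂ (QR q r)
  links {2F} {2F} i≢i _ _ = contradiction refl i≢i

Σ-Fin-zero↔Fin-zero : {B : Fin 0 → Set} → Σ (Fin 0) B ↔ Fin 0
Σ-Fin-zero↔Fin-zero = mk↔ₛ′ (λ ()) (λ ()) (λ ()) (λ ())

Σ-Fin-suc↔⊎ : {B : Fin (suc m) → Set} → Σ (Fin (suc m)) B ↔ (B zero ⊎ Σ (Fin m) (B ∘ suc))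
Σ-Fin-suc↔⊎ = mk↔ₛ′
  (λ { (zero , x) → inj₁ x ; (suc i , y) → inj₂ (i , y) })
  (λ { (inj₁ x) → zero , x ; (inj₂ (i , y)) → suc i , y })
  (λ { (inj₁ _) → refl ; (inj₂ _) → refl })
  (λ { (zero , _) → refl ; (suc _ , _) → refl })

Σ-Fin↔Fin-sum : (s : Fin m → ℕ) → Σ (Fin m) (Fin ∘ s) ↔ Fin (foldr _+_ 0 s)
Σ-Fin↔Fin-sum {zero}  s = Σ-Fin-zero↔Fin-zero
Σ-Fin↔Fin-sum {suc m} s = ↔-sym +↔⊎ ↔-∘ ((↔-id _ ⊎-↔ Σ-Fin↔Fin-sum (s ∘ suc)) ↔-∘ Σ-Fin-suc↔⊎)

Lex-order : {A : Digraph (Fin n)} {G : Digraph (Fin m)} {s : Fin m → ℕ} {H : ∀ i → Digraph (Fin (s i))} →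
  Iso A (Lex G s H) → n ≡ foldr _+_ 0 s
Lex-order {s = s} (f , _) = ↔⇒≡ (Σ-Fin↔Fin-sum s ↔-∘ f)

-- From cones and suspensions to the extremal digraphs

_≅_[K₁,Kₜ,Kₙ₋ₜ₋₁] _≅_[Kₜ,Kₙ₋ₜ₋₁,K₁] : Digraph (Fin n) → Digraph (Fin 3) → Set
_≅_[K₁,Kₜ,Kₙ₋ₜ₋₁] {n} A G = ∃[ t ] (1 ≤ t × t ≤ n ∸ 2 × Iso A (Lex3 G (K 1) (K t) (K (n ∸ t ∸ 1))))
_≅_[Kₜ,Kₙ₋ₜ₋₁,K₁] {n} A G = ∃[ t ] (1 ≤ t × t ≤ n ∸ 2 × Iso A (Lex3 G (K t) (K (n ∸ t ∸ 1)) (K 1)))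

k≤1+k+l∸2 : ∀ k {l} → 1 ≤ l → k ≤ suc (k + l) ∸ 2
k≤1+k+l∸2 k {suc l} _ rewrite ℕ.+-suc k l = ℕ.m≤m+n k l

1+k+l∸k∸1≡l : ∀ k l → suc (k + l) ∸ k ∸ 1 ≡ l
1+k+l∸k∸1≡l k l rewrite sym (ℕ.+-suc k l) | ℕ.m+n∸m≡n k (suc l) = refl

positive-parts⇒∃t : {F : ℕ → ℕ → Set} → ∀ k l → n ≡ suc (k + l) → 1 ≤ k → 1 ≤ l → F k l →
  ∃[ t ] (1 ≤ t × t ≤ n ∸ 2 × F t (n ∸ t ∸ 1))
positive-parts⇒∃t {F = F} k l refl 1≤k 1≤l f =
  k , 1≤k , k≤1+k+l∸2 k 1≤l , subst (F k) (sym (1+k+l∸k∸1≡l k l)) f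

iso⇒≅[K₁,Kₜ,Kₙ₋ₜ₋₁] : {A : Digraph (Fin n)} {G : Digraph (Fin 3)} → ∀ k l → 1 ≤ k → 1 ≤ l →
  Iso A (Lex3 G (K 1) (K k) (K l)) → A ≅ G [K₁,Kₜ,Kₙ₋ₜ₋₁]
iso⇒≅[K₁,Kₜ,Kₙ₋ₜ₋₁] {n} {A} {G} k l 1≤k 1≤l iso =
  positive-parts⇒∃t {F = λ k l → Iso A (Lex3 G (K 1) (K k) (K l))} k l order 1≤k 1≤l iso
  where
  order : n ≡ suc (k + l)
  order = trans (Lex-order iso) (cong (λ l → suc (k + l)) (ℕ.+-identityʳ l))

iso⇒≅[Kₜ,Kₙ₋ₜ₋₁,K₁] : {A : Digraph (Fin n)} {G : Digraph (Fin 3)} → ∀ k l → 1 ≤ k → 1 ≤ l →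
  Iso A (Lex3 G (K k) (K l) (K 1)) → A ≅ G [Kₜ,Kₙ₋ₜ₋₁,K₁]
iso⇒≅[Kₜ,Kₙ₋ₜ₋₁,K₁] {n} {A} {G} k l 1≤k 1≤l iso =
  positive-parts⇒∃t {F = λ k l → Iso A (Lex3 G (K k) (K l) (K 1))} k l order 1≤k 1≤l iso
  where
  order : n ≡ suc (k + l)
  order = trans (Lex-order iso) (trans (cong (k +_) (ℕ.+-comm l 1)) (ℕ.+-suc k l))

module _ {A : Digraph (Fin n)} {s t : Bool × Bool} (cone : Cone A s t) where
  open Cone cone

  seen-induces-K : Loopless A → ∀ r → ∃[ k ] Induces A (Seen r) (K k)
  seen-induces-K loopless r = complete-induces-K loopless
    (λ v → ¬? (apex ≟ v) ×-dec ≡-dec Bool._≟_ Bool._≟_ (⟪ A ⟫ apex v) r)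
    (λ (a≢x , _) (a≢y , _) → complete _ _ a≢x a≢y)

  apex⊎seen : ∀ v → apex ≡ v ⊎ Seen s v ⊎ Seen t v
  apex⊎seen v with apex ≟ v
  ... | yes a≡v = inj₁ a≡v
  ... | no a≢v  = inj₂ (⊎-map (a≢v ,_) (a≢v ,_) (typed a≢v))

  apex-linked : ∀ {r} → Linked A (apex ≡_) (Seen r) r
  apex-linked refl (_ , av) = av

  seen-linked : s ≢ t → Linked A (Seen s) (Seen t) both
  seen-linked s≢t (a≢x , ax) (a≢y , ay) =
    off-apex-joined cone a≢x a≢y λ { refl → s≢t (trans (sym ax) ay) }

fullCone⇒≅[K₁,Kₜ,Kₙ₋ₜ₋₁] : {A : Digraph (Fin n)} {G : Digraph (Fin 3)} → Loopless A → Semicomplete G →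
  ⟪ G ⟫ 0F 1F ≢ ⟪ G ⟫ 0F 2F → ⟪ G ⟫ 1F 2F ≡ both →
  FullCone A (⟪ G ⟫ 0F 1F) (⟪ G ⟫ 0F 2F) → A ≅ G [K₁,Kₜ,Kₙ₋ₜ₋₁]
fullCone⇒≅[K₁,Kₜ,Kₙ₋ₜ₋₁] loopless semicomplete s≢t 1↔2 (cone , s-seen , t-seen)
  with k , S ← seen-induces-K cone loopless _ | l , T ← seen-induces-K cone loopless _ =
  iso⇒≅[K₁,Kₜ,Kₙ₋ₜ₋₁] k l (inhabited⇒1≤order S s-seen) (inhabited⇒1≤order T t-seen)
    (Lex3-iso loopless semicomplete (apex⊎seen cone)
      (singleton-induces-K₁ loopless (Cone.apex cone)) S T
      (apex-linked cone) (apex-linked cone) (λ x y → trans (seen-linked cone s≢t x y) (sym 1↔2)))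

fullCone⇒≅[Kₜ,Kₙ₋ₜ₋₁,K₁] : {A : Digraph (Fin n)} {G : Digraph (Fin 3)} → Loopless A → Semicomplete G →
  ⟪ G ⟫ 2F 0F ≢ ⟪ G ⟫ 2F 1F → ⟪ G ⟫ 0F 1F ≡ both →
  FullCone A (⟪ G ⟫ 2F 0F) (⟪ G ⟫ 2F 1F) → A ≅ G [Kₜ,Kₙ₋ₜ₋₁,K₁]
fullCone⇒≅[Kₜ,Kₙ₋ₜ₋₁,K₁] loopless semicomplete s≢t 0↔1 (cone , s-seen , t-seen)
  with k , S ← seen-induces-K cone loopless _ | l , T ← seen-induces-K cone loopless _ =
  iso⇒≅[Kₜ,Kₙ₋ₜ₋₁,K₁] k l (inhabited⇒1≤order S s-seen) (inhabited⇒1≤order T t-seen)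
    (Lex3-iso loopless semicomplete ([ inj₂ ∘ inj₂ , ⊎-map₂ inj₁ ]′ ∘ apex⊎seen cone)
      S T (singleton-induces-K₁ loopless (Cone.apex cone))
      (λ x y → trans (seen-linked cone s≢t x y) (sym 0↔1))
      (λ x a → cong swap (apex-linked cone a x)) (λ y a → cong swap (apex-linked cone a y)))

module _ {A : Digraph (Fin n)} (loopless : Loopless A) where

  forward-backward-cone⇒extremal : FullCone A forward backward → Extremal n A
  forward-backward-cone⇒extremal cone =
    let t , 1≤t , t≤n∸2 , iso = fullCone⇒≅[K₁,Kₜ,Kₙ₋ₜ₋₁] loopless G1-semicomplete (λ ()) refl cone
    in inj₂ (inj₁ (t , 1≤t , t≤n∸2 , inj₁ iso))

  both-backward-cone⇒extremal : FullCone A both backward → Extremal n A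
  both-backward-cone⇒extremal cone =
    let t , 1≤t , t≤n∸2 , iso = fullCone⇒≅[K₁,Kₜ,Kₙ₋ₜ₋₁] loopless G2-semicomplete (λ ()) refl cone
    in inj₂ (inj₁ (t , 1≤t , t≤n∸2 , inj₂ (inj₁ iso)))

  forward-both-cone⇒extremal : FullCone A forward both → Extremal n A
  forward-both-cone⇒extremal cone =
    let t , 1≤t , t≤n∸2 , iso = fullCone⇒≅[Kₜ,Kₙ₋ₜ₋₁,K₁] loopless G2-semicomplete (λ ()) refl cone
    in inj₂ (inj₁ (t , 1≤t , t≤n∸2 , inj₂ (inj₂ iso)))

module _ {A : Digraph (Fin n)} (loopless : Loopless A) (suspension : Suspension A) where
  open Suspension suspension

  suspension-iso : {H : Digraph (Fin k)} → Induces A Rest H → Iso A (Lex3 G2 (K 1) H (K 1))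
  suspension-iso rest = Lex3-iso loopless G2-semicomplete
    ([ [ inj₂ ∘ inj₂ , inj₁ ]′ , inj₂ ∘ inj₁ ]′ ∘ pole⊎rest suspension)
    (singleton-induces-K₁ loopless target) rest (singleton-induces-K₁ loopless source)
    (λ { refl → target-joined }) (λ { refl refl → cong swap one-way })
    (λ { r refl → cong swap (source-joined r) })

  suspension⇒extremal : Extremal n A
  suspension⇒extremal
    with homogeneous⇒induces-Kbar⊎K⊎P2 loopless (λ v → ¬? (source ≟ v) ×-dec ¬? (target ≟ v)) homogeneous
  ... | induces-P2 rest = inj₁ (suspension-iso rest)
  ... | induces-K {k} rest inhabited =
    let t , 1≤t , t≤n∸2 , iso =
          iso⇒≅[K₁,Kₜ,Kₙ₋ₜ₋₁] k 1 (inhabited⇒1≤order rest inhabited) ℕ.≤-refl (suspension-iso rest)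
    in inj₂ (inj₁ (t , 1≤t , t≤n∸2 , inj₂ (inj₁ iso)))
  ... | induces-Kbar {k} rest = inj₂ (inj₂ (subst (λ k → Iso A (Lex3 G2 (K 1) (Kbar k) (K 1))) k≡n∸2 iso))
    where
    iso : Iso A (Lex3 G2 (K 1) (Kbar k) (K 1))
    iso = suspension-iso rest

    k≡n∸2 : k ≡ n ∸ 2
    k≡n∸2 = sym (trans (cong (_∸ 2) (Lex-order iso)) (ℕ.m+n∸n≡m k 1))

module _ {A : Digraph (Fin n)} (loopless : Loopless A) (connected : StronglyConnected A)
  (triples : TwinTriples ⟪ A ⟫) where

  completeOff-source⇒extremal : ∀ {a b} → ⟪ A ⟫ a b ≡ forward → CompleteOff A a → Extremal n A
  completeOff-source⇒extremal {a} ab complete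
    with y , y→a ← in-neighbour connected (≢-sym (forward⇒≢ A ab))
    with a≢b ← forward⇒≢ A ab | a≢y ← ≢-sym (arc⇒≢ A loopless y→a) | A a y in a→y
  ... | false = forward-backward-cone⇒extremal loopless
    (completeOff⇒fullCone triples complete a≢b a≢y ab (cong₂ _,_ a→y y→a) λ ())
  ... | true  = forward-both-cone⇒extremal loopless
    (completeOff⇒fullCone triples complete a≢b a≢y ab (cong₂ _,_ a→y y→a) λ ())

  completeOff-target⇒extremal : ∀ {a b} → ⟪ A ⟫ a b ≡ forward → CompleteOff A b → Extremal n A
  completeOff-target⇒extremal {b = b} ab complete
    with y , b→y ← out-neighbour connected (≢-sym (forward⇒≢ A ab))
    with b≢a ← ≢-sym (forward⇒≢ A ab) | b≢y ← arc⇒≢ A loopless b→y | A y b in y→b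
  ... | false = forward-backward-cone⇒extremal loopless
    (completeOff⇒fullCone triples complete b≢y b≢a (cong₂ _,_ b→y y→b) (cong swap ab) λ ())
  ... | true  = both-backward-cone⇒extremal loopless
    (completeOff⇒fullCone triples complete b≢y b≢a (cong₂ _,_ b→y y→b) (cong swap ab) λ ())

  twinTriples⇒extremal : Diameter≤2 A → 4 ≤ n → ∀ {a b} → ⟪ A ⟫ a b ≡ forward → Extremal n A
  twinTriples⇒extremal diam 4≤n {a} {b} ab with completeOff? A a | completeOff? A b
  ... | yes a-complete  | _               = completeOff-source⇒extremal ab a-complete
  ... | no _            | yes b-complete  = completeOff-target⇒extremal ab b-complete
  ... | no a-incomplete | no b-incomplete = suspension⇒extremal loopless
    (¬completeOff⇒suspension loopless triples diam 4≤n ab a-incomplete b-incomplete)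

-- From the extremal digraphs to cones and suspensions

module _ {A : Digraph V} {B : Digraph V′} (iso : Iso A B) where
  open Inverse (proj₁ iso)

  ⟪⟫-to : ∀ x y → ⟪ A ⟫ x y ≡ ⟪ B ⟫ (to x) (to y)
  ⟪⟫-to x y = cong₂ _,_ (proj₂ iso x y) (proj₂ iso y x)

  ⟪⟫-from : ∀ b v → ⟪ A ⟫ (from b) v ≡ ⟪ B ⟫ b (to v)
  ⟪⟫-from b v = trans (⟪⟫-to (from b) v) (cong (λ u → ⟪ B ⟫ u (to v)) (strictlyInverseˡ b))

  to-≢ : ∀ {x y} → x ≢ y → to x ≢ to y
  to-≢ {x} {y} x≢y eq = x≢y (trans (sym (strictlyInverseʳ x)) (trans (cong from eq) (strictlyInverseʳ y)))

  from-≢ : ∀ {b v} → from b ≢ v → b ≢ to v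
  from-≢ {b} {v} b≢v eq = b≢v (trans (cong from eq) (strictlyInverseʳ v))

  iso⇒cone : ∀ {s t} → Cone B s t → Cone A s t
  iso⇒cone cone = record
    { apex     = from apex
    ; complete = λ u v a≢u a≢v u≢v → trans (proj₂ iso u v)
        (complete (to u) (to v) (from-≢ a≢u) (from-≢ a≢v) (to-≢ u≢v))
    ; typed    = λ {v} a≢v → ⊎-map (trans (⟪⟫-from apex v)) (trans (⟪⟫-from apex v)) (typed (from-≢ a≢v))
    }
    where open Cone cone

  iso⇒suspension : Suspension B → Suspension A
  iso⇒suspension suspension = record
    { source        = from source
    ; target        = from target
    ; one-way       = trans (⟪⟫-from source (from target))
        (trans (cong (⟪ B ⟫ source) (strictlyInverseˡ target)) one-way)
    ; source-joined = λ {v} rv → trans (⟪⟫-from source v) (source-joined (rest rv))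
    ; target-joined = λ {v} rv → trans (⟪⟫-from target v) (target-joined (rest rv))
    ; homogeneous   = λ {w} {x} {y} rw rx ry w≢x w≢y → trans (⟪⟫-to w x) (trans
        (homogeneous (rest rw) (rest rx) (rest ry) (to-≢ w≢x) (to-≢ w≢y)) (sym (⟪⟫-to w y)))
    }
    where
    open Suspension suspension

    rest : ∀ {v} → from source ≢ v × from target ≢ v → Rest (to v)
    rest = map from-≢ from-≢

K-complete : {x y : Fin n} → x ≢ y → K n x y ≡ true
K-complete {x = x} {y} x≢y with x ≟ y
... | yes x≡y = contradiction x≡y x≢y
... | no _    = refl

G[K₁,K,K]-cone : (G : Digraph (Fin 3)) → ⟪ G ⟫ 1F 2F ≡ both →
  Cone (Lex3 G (K 1) (K k) (K l)) (⟪ G ⟫ 0F 1F) (⟪ G ⟫ 0F 2F)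
G[K₁,K,K]-cone {k} {l} G 1↔2 = record
  { apex     = 0F , 0F
  ; complete = complete
  ; typed    = λ
      { {0F , 0F} a≢a → contradiction refl a≢a
      ; {1F , _}  _   → inj₁ refl
      ; {2F , _}  _   → inj₂ refl
      }
  }
  where
  complete : CompleteOff (Lex3 G (K 1) (K k) (K l)) (0F , 0F)
  complete (0F , 0F) _         a≢a _   _   = contradiction refl a≢a
  complete _         (0F , 0F) _   a≢a _   = contradiction refl a≢a
  complete (1F , _)  (1F , _)  _   _   u≢v = K-complete λ { refl → u≢v refl }
  complete (1F , _)  (2F , _)  _   _   _   = cong proj₁ 1↔2
  complete (2F , _)  (1F , _)  _   _   _   = cong proj₂ 1↔2
  complete (2F , _)  (2F , _)  _   _   u≢v = K-complete λ { refl → u≢v refl }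

G[K,K,K₁]-cone : (G : Digraph (Fin 3)) → ⟪ G ⟫ 0F 1F ≡ both →
  Cone (Lex3 G (K k) (K l) (K 1)) (⟪ G ⟫ 2F 0F) (⟪ G ⟫ 2F 1F)
G[K,K,K₁]-cone {k} {l} G 0↔1 = record
  { apex     = 2F , 0F
  ; complete = complete
  ; typed    = λ
      { {0F , _}  _   → inj₁ refl
      ; {1F , _}  _   → inj₂ refl
      ; {2F , 0F} a≢a → contradiction refl a≢a
      }
  }
  where
  complete : CompleteOff (Lex3 G (K k) (K l) (K 1)) (2F , 0F)
  complete (2F , 0F) _         a≢a _   _   = contradiction refl a≢a
  complete _         (2F , 0F) _   a≢a _   = contradiction refl a≢a
  complete (0F , _)  (0F , _)  _   _   u≢v = K-complete λ { refl → u≢v refl }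
  complete (0F , _)  (1F , _)  _   _   _   = cong proj₁ 0↔1
  complete (1F , _)  (0F , _)  _   _   _   = cong proj₂ 0↔1
  complete (1F , _)  (1F , _)  _   _   u≢v = K-complete λ { refl → u≢v refl }

G2[K₁,H,K₁]-suspension : {H : Digraph (Fin k)} → Homogeneous H U → Suspension (Lex3 G2 (K 1) H (K 1))
G2[K₁,H,K₁]-suspension {k} homogeneous = record
  { source        = 2F , 0F
  ; target        = 0F , 0F
  ; one-way       = refl
  ; source-joined = λ r → case middle r of λ { (_ , refl) → refl }
  ; target-joined = λ r → case middle r of λ { (_ , refl) → refl }
  ; homogeneous   = λ rw rx ry → case (middle rw , middle rx , middle ry) of
      λ { ((_ , refl) , (_ , refl) , (_ , refl)) w≢x w≢y →
        homogeneous _ _ _ (w≢x ∘ cong (1F ,_)) (w≢y ∘ cong (1F ,_)) }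
  }
  where
  middle : {v : Σ (Fin 3) (Fin ∘ size3 1 k 1)} → (2F , 0F) ≢ v × (0F , 0F) ≢ v → ∃[ x ] (1F , x) ≡ v
  middle {0F , 0F} (_ , t≢t) = contradiction refl t≢t
  middle {1F , x}  _         = x , refl
  middle {2F , 0F} (s≢s , _) = contradiction refl s≢s

Kbar-homogeneous : Homogeneous (Kbar n) U
Kbar-homogeneous _ _ _ _ _ = refl

P2-homogeneous : Homogeneous P2 U
P2-homogeneous {w} {x} {y} _ _ _ w≢x w≢y =
  cong (⟪ P2 ⟫ w) (in-pair-≢⇒≡ (zero⊎one w) (zero⊎one x) (zero⊎one y) w≢x w≢y)
  where
  zero⊎one : (i : Fin 2) → 0F ≡ i ⊎ 1F ≡ i
  zero⊎one 0F = inj₁ refl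
  zero⊎one 1F = inj₂ refl

extremal⇒cone⊎suspension : {A : Digraph (Fin n)} → Extremal n A → ∃₂ (Cone A) ⊎ Suspension A
extremal⇒cone⊎suspension (inj₁ iso) =
  inj₂ (iso⇒suspension iso (G2[K₁,H,K₁]-suspension P2-homogeneous))
extremal⇒cone⊎suspension (inj₂ (inj₂ iso)) =
  inj₂ (iso⇒suspension iso (G2[K₁,H,K₁]-suspension Kbar-homogeneous))
extremal⇒cone⊎suspension (inj₂ (inj₁ (_ , _ , _ , inj₁ iso))) =
  inj₁ (_ , _ , iso⇒cone iso (G[K₁,K,K]-cone G1 refl))
extremal⇒cone⊎suspension (inj₂ (inj₁ (_ , _ , _ , inj₂ (inj₁ iso)))) =
  inj₁ (_ , _ , iso⇒cone iso (G[K₁,K,K]-cone G2 refl))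
extremal⇒cone⊎suspension (inj₂ (inj₁ (_ , _ , _ , inj₂ (inj₂ iso)))) =
  inj₁ (_ , _ , iso⇒cone iso (G[K,K,K₁]-cone G2 refl))

extremal⇒twinTriples : {A : Digraph (Fin n)} → Loopless A → StronglyConnected A →
  Extremal n A → TwinTriples ⟪ A ⟫ × Diameter≤2 A
extremal⇒twinTriples loopless connected extremal with extremal⇒cone⊎suspension extremal
... | inj₁ (_ , _ , cone) = cone⇒twinTriples cone , cone⇒diameter≤2 cone loopless connected
... | inj₂ suspension     =
  suspension⇒twinTriples suspension , suspension⇒diameter≤2 suspension loopless connected

¬undirected⇒one-way-arc : {A : Digraph (Fin n)} → ¬ Undirected A → ∃[ a ] ∃[ b ] ⟪ A ⟫ a b ≡ forward
¬undirected⇒one-way-arc {A = A} ¬undirected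
  with any? (λ a → any? (λ b → ≡-dec Bool._≟_ Bool._≟_ (⟪ A ⟫ a b) forward))
... | yes arc = arc
... | no ∄arc = contradiction
  (λ x y x→y → Bool.¬-not λ y↛x → ∄arc (x , y , cong₂ _,_ x→y y↛x)) ¬undirected

theorem4p2 : (n : ℕ) (A : Digraph (Fin n)) → 4 ≤ n → Loopless A → StronglyConnected A
    → ¬ Undirected A → (HasDim A (n ∸ 2) ⇔ Extremal n A)
theorem4p2 n A 4≤n loopless connected ¬undirected with a , b , ab ← ¬undirected⇒one-way-arc ¬undirected =
  HasDim A (n ∸ 2)                    ∼⟨ dim⇔dist-twinTriples connected loopless ab ⟩
  TwinTriples ⟪ ∂ connected ⟫         ∼⟨ dist-twinTriples⇔arc-twinTriples connected ⟩
  (TwinTriples ⟪ A ⟫ × Diameter≤2 A)  ∼⟨ mk⇔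
    (λ (triples , diam) → twinTriples⇒extremal loopless connected triples diam 4≤n ab)
    (extremal⇒twinTriples loopless connected) ⟩
  Extremal n A                        ∎
  where open EquationalReasoning
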